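{- The union of the sets of $r$-graph Turán densities over all integers $r\ge 2$ is dense in $[0,1]$; that is, the topological closure of $\bigcup_{r=2}^\infty \Pi_\infty^{(r)}$ equals $[0,1]$.
   Context: Let $r\ge 2$ be an integer. An $r$-graph is an $r$-uniform set system, i.e. a finite vertex set together with a collection of $r$-element subsets of it (edges). Let $\mathcal F$ be a (possibly infinite, possibly empty) family of $r$-graphs, each having at least one edge. An $r$-graph $G$ is $\mathcal F$-free if no member $F\in\mathcal F$ is a subgraph of $G$, i.e. no $F\in\mathcal F$ can be obtained (up to isomorphism) by deleting some vertices and edges from $G$ (subgraphs are not required to be induced). The Turán function $\mathrm{ex}(n,\mathcal F)$ is the maximum number of edges in an $\mathcal F$-free $r$-graph on $n$ vertices. The Turán density of $\mathcal F$ is $\pi(\mathcal F):=\lim_{n\to\infty}\mathrm{ex}(n,\mathcal F)/\binom{n}{r}$ (the limit is known to exist). $\Pi_\infty^{(r)}\subseteq[0,1]$ denotes the set of all values $\pi(\mathcal F)$ over all such families $\mathcal F$ of $r$-graphs (finite or infinite; the empty family is allowed, so $1\in\Pi_\infty^{(r)}$). -}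

module Defs where

open import Data.Fin.Base using (Fin)
import Data.Fin.Properties as Fin
open import Data.Fin.Subset as Subset using (Subset)
open import Data.Fin.Subset.Properties using (_∈?_)
open import Data.Integer.Base using (+_)
open import Data.List.Base using (List; length)
open import Data.List.Membership.Propositional using () renaming (_∈_ to _∈ˡ_)
open import Data.List.Relation.Unary.All using (All)
open import Data.List.Relation.Unary.Unique.Propositional using (Unique)
open import Data.Nat.Base as ℕ using (ℕ; zero; suc)
open import Data.Nat.Combinatorics using (_C_)
import Data.Nat.Properties as ℕ
open import Data.Product.Base using (∃; ∃-syntax; Σ-syntax; _×_; _,_)
open import Data.Rational.Base as ℚ using (ℚ; 0ℚ; 1ℚ; ½)
import Data.Rational.Properties as ℚ
open import Data.Rational.Solver using (module +-*-Solver)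
open import Data.Sum.Base using (inj₁; inj₂)
open import Data.Vec.Base using (tabulate)
open import Function.Definitions using (Injective)
open import Level using (Level; 0ℓ) renaming (suc to lsuc)
open import Relation.Binary.PropositionalEquality
  using (_≡_; refl; sym; trans; cong; subst)
open import Relation.Nullary using (¬_)
open import Relation.Nullary.Decidable using (does; _×-dec_)
open import Relation.Unary using (Pred; _∈_)

private
  variable
    ℓ : Level

-- Real numbers as Cauchy sequences of rationals.  No quotient is taken;
-- every notion below respects equality of limits.

record ℝ : Set where
  field
    seq    : ℕ → ℚ
    cauchy : ∀ ε → 0ℚ ℚ.< ε →
             ∃[ N ] (∀ m n → N ℕ.≤ m → N ℕ.≤ n → ℚ.∣ seq m ℚ.- seq n ∣ ℚ.< ε)

open ℝ public

private
  ½*-pos : ∀ {ε} → 0ℚ ℚ.< ε → 0ℚ ℚ.< ½ ℚ.* ε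
  ½*-pos {ε} 0<ε = subst (ℚ._< ½ ℚ.* ε) (ℚ.*-zeroʳ ½) (ℚ.*-monoʳ-<-pos ½ 0<ε)

  ½*+½* : ∀ ε → ½ ℚ.* ε ℚ.+ ½ ℚ.* ε ≡ ε
  ½*+½* ε = trans (sym (ℚ.*-distribʳ-+ ε ½ ½)) (ℚ.*-identityˡ ε)

  ∣p-q∣≡∣q-p∣ : ∀ p q → ℚ.∣ p ℚ.- q ∣ ≡ ℚ.∣ q ℚ.- p ∣
  ∣p-q∣≡∣q-p∣ p q = trans (cong ℚ.∣_∣ (lemma p q)) (ℚ.∣-p∣≡∣p∣ (q ℚ.- p))
    where
    open +-*-Solver
    lemma : ∀ p q → p ℚ.- q ≡ ℚ.- (q ℚ.- p)
    lemma = solve 2 (λ p q → p :- q := :- (q :- p)) refl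

  ∣p∣-∣q∣≤∣p-q∣ : ∀ p q → ℚ.∣ p ∣ ℚ.- ℚ.∣ q ∣ ℚ.≤ ℚ.∣ p ℚ.- q ∣
  ∣p∣-∣q∣≤∣p-q∣ p q = begin
    ℚ.∣ p ∣ ℚ.- ℚ.∣ q ∣                         ≡⟨ cong (λ x → ℚ.∣ x ∣ ℚ.- ℚ.∣ q ∣) (split p q) ⟩
    ℚ.∣ (p ℚ.- q) ℚ.+ q ∣ ℚ.- ℚ.∣ q ∣           ≤⟨ ℚ.+-monoˡ-≤ (ℚ.- ℚ.∣ q ∣) (ℚ.∣p+q∣≤∣p∣+∣q∣ (p ℚ.- q) q) ⟩
    (ℚ.∣ p ℚ.- q ∣ ℚ.+ ℚ.∣ q ∣) ℚ.- ℚ.∣ q ∣     ≡⟨ cancel ℚ.∣ p ℚ.- q ∣ ℚ.∣ q ∣ ⟩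
    ℚ.∣ p ℚ.- q ∣                               ∎
    where
    open ℚ.≤-Reasoning
    open +-*-Solver
    split : ∀ p q → p ≡ (p ℚ.- q) ℚ.+ q
    split = solve 2 (λ p q → p := (p :- q) :+ q) refl
    cancel : ∀ a b → (a ℚ.+ b) ℚ.- b ≡ a
    cancel = solve 2 (λ a b → (a :+ b) :- b := a) refl

  ∣∣p∣-∣q∣∣≤∣p-q∣ : ∀ p q → ℚ.∣ ℚ.∣ p ∣ ℚ.- ℚ.∣ q ∣ ∣ ℚ.≤ ℚ.∣ p ℚ.- q ∣
  ∣∣p∣-∣q∣∣≤∣p-q∣ p q with ℚ.∣p∣≡p∨∣p∣≡-p (ℚ.∣ p ∣ ℚ.- ℚ.∣ q ∣)
  ... | inj₁ eq = subst (ℚ._≤ ℚ.∣ p ℚ.- q ∣) (sym eq) (∣p∣-∣q∣≤∣p-q∣ p q)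
  ... | inj₂ eq = begin
    ℚ.∣ ℚ.∣ p ∣ ℚ.- ℚ.∣ q ∣ ∣    ≡⟨ eq ⟩
    ℚ.- (ℚ.∣ p ∣ ℚ.- ℚ.∣ q ∣)    ≡⟨ swap ℚ.∣ p ∣ ℚ.∣ q ∣ ⟩
    ℚ.∣ q ∣ ℚ.- ℚ.∣ p ∣          ≤⟨ ∣p∣-∣q∣≤∣p-q∣ q p ⟩
    ℚ.∣ q ℚ.- p ∣                ≡⟨ ∣p-q∣≡∣q-p∣ q p ⟩
    ℚ.∣ p ℚ.- q ∣                ∎
    where
    open ℚ.≤-Reasoning
    open +-*-Solver
    swap : ∀ a b → ℚ.- (a ℚ.- b) ≡ b ℚ.- a
    swap = solve 2 (λ a b → :- (a :- b) := b :- a) refl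

fromℚ : ℚ → ℝ
fromℚ q .seq _ = q
fromℚ q .cauchy ε 0<ε =
  0 , λ _ _ _ _ → subst (ℚ._< ε) (cong ℚ.∣_∣ (sym (ℚ.+-inverseʳ q))) 0<ε

0ℝ 1ℝ : ℝ
0ℝ = fromℚ 0ℚ
1ℝ = fromℚ 1ℚ

infixl 6 _-_
_-_ : ℝ → ℝ → ℝ
(x - y) .seq n = seq x n ℚ.- seq y n
(x - y) .cauchy ε 0<ε
  with M , hx ← cauchy x (½ ℚ.* ε) (½*-pos 0<ε)
     | N , hy ← cauchy y (½ ℚ.* ε) (½*-pos 0<ε)
  = M ℕ.⊔ N , λ m n m≥ n≥ → begin-strict
    ℚ.∣ (seq x m ℚ.- seq y m) ℚ.- (seq x n ℚ.- seq y n) ∣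
      ≡⟨ cong ℚ.∣_∣ (regroup (seq x m) (seq y m) (seq x n) (seq y n)) ⟩
    ℚ.∣ (seq x m ℚ.- seq x n) ℚ.+ (seq y n ℚ.- seq y m) ∣
      ≤⟨ ℚ.∣p+q∣≤∣p∣+∣q∣ (seq x m ℚ.- seq x n) (seq y n ℚ.- seq y m) ⟩
    ℚ.∣ seq x m ℚ.- seq x n ∣ ℚ.+ ℚ.∣ seq y n ℚ.- seq y m ∣
      <⟨ ℚ.+-mono-< (hx m n (ℕ.m⊔n≤o⇒m≤o M N m≥) (ℕ.m⊔n≤o⇒m≤o M N n≥))
                    (hy n m (ℕ.m⊔n≤o⇒n≤o M N n≥) (ℕ.m⊔n≤o⇒n≤o M N m≥)) ⟩
    ½ ℚ.* ε ℚ.+ ½ ℚ.* ε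
      ≡⟨ ½*+½* ε ⟩
    ε ∎
  where
  open ℚ.≤-Reasoning
  open +-*-Solver
  regroup : ∀ a b c d → (a ℚ.- b) ℚ.- (c ℚ.- d) ≡ (a ℚ.- c) ℚ.+ (d ℚ.- b)
  regroup = solve 4 (λ a b c d → (a :- b) :- (c :- d) := (a :- c) :+ (d :- b)) refl

∣_∣ : ℝ → ℝ
∣ x ∣ .seq n = ℚ.∣ seq x n ∣
∣ x ∣ .cauchy ε 0<ε with N , h ← cauchy x ε 0<ε
  = N , λ m n m≥ n≥ →
    ℚ.≤-<-trans (∣∣p∣-∣q∣∣≤∣p-q∣ (seq x m) (seq x n)) (h m n m≥ n≥)

infix 4 _<_ _≤_

_<_ : ℝ → ℝ → Set
x < y = ∃[ δ ] (0ℚ ℚ.< δ × ∃[ N ] (∀ n → N ℕ.≤ n → seq x n ℚ.+ δ ℚ.≤ seq y n))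

_≤_ : ℝ → ℝ → Set
x ≤ y = ¬ (y < x)

[0,1] : Pred ℝ 0ℓ
[0,1] x = 0ℝ ≤ x × x ≤ 1ℝ

closure : Pred ℝ ℓ → Pred ℝ ℓ
closure S x = ∀ (ε : ℝ) → 0ℝ < ε → ∃[ y ] (y ∈ S × ∣ y - x ∣ < ε)

infix 4 _⟶_
_⟶_ : (ℕ → ℚ) → ℝ → Set
u ⟶ x = ∀ (ε : ℝ) → 0ℝ < ε → ∃[ N ] (∀ n → N ℕ.≤ n → ∣ fromℚ (u n) - x ∣ < ε)


-- An r-graph with vertex set Fin n.  The edges form a set, listed in
-- some order without repetition.
record RGraph (r n : ℕ) : Set where
  field
    edges   : List (Subset n)
    unique  : Unique edges
    uniform : All (λ e → Subset.∣ e ∣ ≡ r) edges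

  size : ℕ
  size = length edges

open RGraph public

image : ∀ {m n} → (Fin m → Fin n) → Subset m → Subset n
image f p = tabulate λ j → does (Fin.any? λ i → (i ∈? p) ×-dec (f i Fin.≟ j))

-- Not necessarily induced, and up to isomorphism.
_IsSubgraphOf_ : ∀ {r m n} → RGraph r m → RGraph r n → Set
_IsSubgraphOf_ {r} {m} {n} F G =
  ∃[ f ] (Injective {A = Fin m} {B = Fin n} _≡_ _≡_ f ×
          (∀ e → e ∈ˡ edges F → image f e ∈ˡ edges G))

-- A possibly empty or infinite family.
record Family (r : ℕ) : Set₁ where
  field
    member  : ∀ {n} → RGraph r n → Set
    hasEdge : ∀ {n} (F : RGraph r n) → member F → 1 ℕ.≤ size F

open Family public

module _ {r : ℕ} (𝓕 : Family r) where

  Free : ∀ {n} → RGraph r n → Set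
  Free G = ∀ {m} (F : RGraph r m) → member 𝓕 F → ¬ (F IsSubgraphOf G)

  -- ex(n, 𝓕) = k.  A relation, because for an undecidable family the
  -- maximum cannot be computed.
  IsEx : ℕ → ℕ → Set
  IsEx n k = (∃[ G ] (Free {n} G × size G ≡ k)) ×
             (∀ (G : RGraph r n) → Free G → size G ℕ.≤ k)

-- The value at denominator 0 is arbitrary; below it is used only
-- at the finitely many n < r, where n C r = 0.
ratio : ℕ → ℕ → ℚ
ratio a zero    = 0ℚ
ratio a (suc b) = + a ℚ./ suc b

IsTuránDensity : ∀ {r} → Family r → ℝ → Set
IsTuránDensity {r} 𝓕 p =
  Σ[ ex ∈ (ℕ → ℕ) ] ((∀ n → IsEx 𝓕 n (ex n)) × (λ n → ratio (ex n) (n C r)) ⟶ p)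

Π∞ : ℕ → Pred ℝ (lsuc 0ℓ)
Π∞ r p = ∃ λ (𝓕 : Family r) → IsTuránDensity 𝓕 p

{-# OPTIONS --safe #-}

-- For each K and r, take the r-graphs whose vertices cannot be coloured with
-- K colours so that every edge is rainbow.  The graphs free of them are the
-- subgraphs of complete K-partite r-graphs, so ex(n) is the largest value of
-- the elementary symmetric polynomial e_r at the class sizes of a colouring.
-- Averaging over all colourings bounds it from below and Maclaurin's
-- inequality from above, and the density is K(K-1)...(K-r+1) / K^r.
-- For fixed K this is ∏ (1 - i / K) over i < r: it starts near 1, decreases by
-- at most r / K at step r, and is small once r² is large compared to K.  With
-- s ≈ 2/ε² and K ≈ s/ε, the values at r ≤ s are therefore ε-dense in [0,1].
module Submission where

open import Defs hiding (_<_; _≤_; _-_; ∣_∣)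
import Defs as Real
import Algebra.Properties.Semiring.Sum as Sum
open import Data.Bool.Base using (Bool; true; false; if_then_else_)
open import Data.Fin.Base using (Fin; zero; suc)
import Data.Fin.Properties as Fin
open import Data.Fin.Subset as Subset using (Subset; inside; outside)
open import Data.Fin.Subset.Properties using (_∈?_)
import Data.Integer.Base as ℤ
import Data.Integer.Properties as ℤ
open import Data.List.Base as List using (List; length; map; _++_) renaming ([] to []ˡ; _∷_ to _∷ˡ_)
open import Data.List.Properties using (length-map; length-++)
open import Data.List.Membership.Propositional using () renaming (_∈_ to _∈ˡ_)
open import Data.List.Membership.Propositional.Properties
  using (∈-map⁺; ∈-map⁻; ∈-++⁺ˡ; ∈-++⁺ʳ; ∈-++⁻; ∈-lookup; ∈-length)
open import Data.List.Relation.Binary.Disjoint.Propositional using (Disjoint)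
import Data.List.Relation.Unary.All as All
open import Data.List.Relation.Unary.AllPairs using () renaming ([] to []ᵘ; _∷_ to _∷ᵘ_)
open import Data.List.Relation.Unary.Any as Any using (here; there)
open import Data.List.Relation.Unary.Any.Properties using (lookup-index)
open import Data.List.Relation.Unary.Unique.Propositional using (Unique)
import Data.List.Relation.Unary.Unique.Propositional.Properties as Unique
open import Data.Nat.Base as ℕ hiding (_/_)
open import Data.Nat.Base using (ℕ) renaming (_≤_ to _≤ℕ_)
open import Data.Nat.Combinatorics using (_C_; nCk+nC[k+1]≡[n+1]C[k+1]; k>n⇒nCk≡0)
open import Data.Nat.Properties
open import Data.Nat.Tactic.RingSolver using (solve-∀)
open import Data.Product.Base using (∃-syntax; _×_; _,_; proj₁; proj₂)
open import Data.Rational.Base as ℚ using (ℚ; 0ℚ; 1ℚ; ½; mkℚ)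
import Data.Rational.Properties as ℚ
open import Data.Rational.Solver using (module +-*-Solver)
open import Data.Rational.Unnormalised.Base as ℚᵘ using (mkℚᵘ)
import Data.Rational.Unnormalised.Properties as ℚᵘ
open import Data.Sum.Base using (_⊎_; inj₁; inj₂)
open import Data.Vec.Base as Vec
  using (Vec; []; _∷_; _[_]≔_; updateAt; replicate; lookup; tabulate; here; there)
open import Data.Vec.Properties as Vec
  using (∷-injectiveʳ; lookup∘update; lookup∘update′; updateAt-updateAt; updateAt-commutes;
         lookup∘tabulate; lookup-replicate; lookup⇒[]=; []=⇒lookup)
open import Function.Base using (_∘_)
open import Relation.Binary.PropositionalEquality
  using (_≡_; _≢_; refl; sym; trans; cong; cong₂; subst; subst₂; module ≡-Reasoning)
open import Relation.Nullary using (contradiction; ¬_; yes; no)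
open import Relation.Nullary.Decidable using (does; _×-dec_; decidable-stable; dec-true; dec-false)
open import Relation.Unary using (_∈_; _≐_)

open Sum +-*-semiring using (∑-distrib-+; *-distribˡ-sum; sum-cong-≗) renaming (sum to ∑)
open +-*-Solver using (solve; con; _:+_; _:-_; :-_; _:=_)

private
  variable
    k n r : ℕ

-- Falling factorials

infixl 8 _^̲_
_^̲_ : ℕ → ℕ → ℕ
n ^̲ zero  = 1
n ^̲ suc r = n ^̲ r * (n ∸ r)

^̲-vanish : ∀ {n r} → n < r → n ^̲ r ≡ 0
^̲-vanish {n} {suc r} (s≤s n≤r) =
  trans (cong (n ^̲ r *_) (m≤n⇒m∸n≡0 n≤r)) (*-zeroʳ (n ^̲ r))

^̲-suc : ∀ n r → suc n ^̲ suc r ≡ suc n * n ^̲ r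
^̲-suc n zero = *-comm 1 (suc n)
^̲-suc n (suc r) = trans (cong (_* (n ∸ r)) (^̲-suc n r)) (*-assoc (suc n) (n ^̲ r) (n ∸ r))

^̲≤^ : ∀ n r → n ^̲ r ≤ n ^ r
^̲≤^ n zero = ≤-refl
^̲≤^ n (suc r) = subst (n ^̲ r * (n ∸ r) ≤_) (*-comm (n ^ r) n) (*-mono-≤ (^̲≤^ n r) (m∸n≤m n r))

-- This additive recurrence stands in for `n ∸ r` in later estimates. It survives truncation of the
-- subtraction, since all three products vanish for `n < r`.
^̲-split : ∀ n r → n ^̲ suc r + n ^̲ r * r ≡ n ^̲ r * n
^̲-split n r with ≤-total r n
... | inj₁ r≤n = trans (sym (*-distribˡ-+ (n ^̲ r) (n ∸ r) r)) (cong (n ^̲ r *_) (m∸n+n≡m r≤n))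
... | inj₂ n≤r with m≤n⇒m<n∨m≡n n≤r
...   | inj₁ n<r rewrite ^̲-vanish n<r = refl
...   | inj₂ refl rewrite n∸n≡0 n | *-zeroʳ (n ^̲ n) = refl

-- Induction by Pascal's rule. Multiplying by `r !` is how the estimates below trade binomial
-- coefficients for falling factorials.
C*!≡^̲ : ∀ n r → (n C r) * r ! ≡ n ^̲ r
C*!≡^̲ n zero = refl
C*!≡^̲ zero (suc r) =
  trans (cong (_* suc r !) (k>n⇒nCk≡0 {0} {suc r} z<s)) (sym (^̲-vanish {0} {suc r} z<s))
C*!≡^̲ (suc n) (suc r) = begin
  (suc n C suc r) * (suc r * r !)
    ≡⟨ cong (_* (suc r * r !)) (nCk+nC[k+1]≡[n+1]C[k+1] n r) ⟨
  ((n C r) + (n C suc r)) * (suc r * r !)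
    ≡⟨ regroup (n C r) (n C suc r) r (r !) ⟩
  (n C r) * r ! * suc r + (n C suc r) * (suc r * r !)
    ≡⟨ cong₂ (λ x y → x * suc r + y) (C*!≡^̲ n r) (C*!≡^̲ n (suc r)) ⟩
  n ^̲ r * suc r + n ^̲ suc r
    ≡⟨ regroup′ (n ^̲ r) r (n ^̲ suc r) ⟩
  n ^̲ r + (n ^̲ suc r + n ^̲ r * r)
    ≡⟨ cong (n ^̲ r +_) (^̲-split n r) ⟩
  n ^̲ r + n ^̲ r * n
    ≡⟨ regroup″ (n ^̲ r) n ⟩
  suc n * n ^̲ r
    ≡⟨ ^̲-suc n r ⟨
  suc n ^̲ suc r ∎
  where
  open ≡-Reasoning
  regroup : ∀ a b r f → (a + b) * (suc r * f) ≡ a * f * suc r + b * (suc r * f)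
  regroup = solve-∀
  regroup′ : ∀ a r b → a * suc r + b ≡ a + (b + a * r)
  regroup′ = solve-∀
  regroup″ : ∀ a n → a + a * n ≡ suc n * a
  regroup″ = solve-∀

-- n ^̲ r / n ^ r ≥ 1 - r² / n
^≤^̲+error : ∀ n r → n * n ^ r ≤ n * n ^̲ r + r * r * n ^ r
^≤^̲+error n zero = m≤m+n (n * 1) 0
^≤^̲+error n (suc r) = begin
  n * (n * n ^ r)
    ≤⟨ *-monoʳ-≤ n (^≤^̲+error n r) ⟩
  n * (n * n ^̲ r + r * r * n ^ r)
    ≡⟨ regroup n (n ^̲ r) r (n ^ r) ⟩
  n * (n ^̲ r * n) + r * r * (n * n ^ r)
    ≡⟨ cong (λ x → n * x + r * r * (n * n ^ r)) (^̲-split n r) ⟨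
  n * (n ^̲ suc r + n ^̲ r * r) + r * r * (n * n ^ r)
    ≤⟨ +-monoˡ-≤ _ (*-monoʳ-≤ n (+-monoʳ-≤ (n ^̲ suc r) (*-monoˡ-≤ r (^̲≤^ n r)))) ⟩
  n * (n ^̲ suc r + n ^ r * r) + r * r * (n * n ^ r)
    -- Consecutive squares differ by `r + suc r`. The previous step used `r` of this; the remaining
    -- `suc r` is given away to keep the error a plain square.
    ≤⟨ m≤m+n _ (suc r * (n * n ^ r)) ⟩
  n * (n ^̲ suc r + n ^ r * r) + r * r * (n * n ^ r) + suc r * (n * n ^ r)
    ≡⟨ regroup′ n (n ^̲ suc r) r (n ^ r) ⟩
  n * n ^̲ suc r + suc r * suc r * (n * n ^ r) ∎
  where
  open ≤-Reasoning
  regroup : ∀ n f r p → n * (n * f + r * r * p) ≡ n * (f * n) + r * r * (n * p)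
  regroup = solve-∀
  regroup′ : ∀ n f r p → n * (f + p * r) + r * r * (n * p) + suc r * (n * p) ≡ n * f + suc r * suc r * (n * p)
  regroup′ = solve-∀

triangle : ℕ → ℕ
triangle zero = 0
triangle (suc r) = triangle r + r

-- ∏ (1 - i / k) · (1 + ∑ i / k) ≤ 1, the product and the sum being over i < r
^̲-triangle : ∀ k r → k ^̲ r * (k + triangle r) ≤ k * k ^ r
^̲-triangle k zero = ≤-reflexive (base k)
  where
  base : ∀ k → 1 * (k + 0) ≡ k * 1
  base = solve-∀
^̲-triangle k (suc r) = begin
  k ^̲ suc r * (k + (t + r))
    ≡⟨ regroup (k ^̲ suc r) k t r ⟩
  k ^̲ suc r * (k + t) + k ^̲ suc r * r
    ≤⟨ +-monoʳ-≤ _ (*-monoˡ-≤ r (*-monoʳ-≤ (k ^̲ r) (m∸n≤m k r))) ⟩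
  k ^̲ suc r * (k + t) + k ^̲ r * k * r
    -- The surplus term completes a factor `k + t`, so that `^̲-split` applies to the cofactor.
    ≤⟨ +-monoʳ-≤ (k ^̲ suc r * (k + t)) (m≤m+n _ (k ^̲ r * t * r)) ⟩
  k ^̲ suc r * (k + t) + (k ^̲ r * k * r + k ^̲ r * t * r)
    ≡⟨ regroup′ (k ^̲ suc r) (k ^̲ r) k t r ⟩
  (k ^̲ suc r + k ^̲ r * r) * (k + t)
    ≡⟨ cong (_* (k + t)) (^̲-split k r) ⟩
  k ^̲ r * k * (k + t)
    ≡⟨ regroup″ (k ^̲ r) k t ⟩
  k * (k ^̲ r * (k + t))
    ≤⟨ *-monoʳ-≤ k (^̲-triangle k r) ⟩
  k * (k * k ^ r) ∎
  where
  open ≤-Reasoning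
  t = triangle r
  regroup : ∀ f k t r → f * (k + (t + r)) ≡ f * (k + t) + f * r
  regroup = solve-∀
  regroup′ : ∀ f g k t r → f * (k + t) + (g * k * r + g * t * r) ≡ (f + g * r) * (k + t)
  regroup′ = solve-∀
  regroup″ : ∀ g k t → g * k * (k + t) ≡ k * (g * (k + t))
  regroup″ = solve-∀

-- Tangent inequality for powers

2xy≤x²+y² : ∀ x y → 2 * (x * y) ≤ x * x + y * y
2xy≤x²+y² x y with ≤-total x y
... | inj₁ x≤y = subst (λ y → 2 * (x * y) ≤ x * x + y * y) (m+[n∸m]≡n x≤y)
  (subst (2 * (x * (x + d)) ≤_) (square x d) (m≤m+n _ (d * d)))
  where
  d = y ∸ x
  square : ∀ x d → 2 * (x * (x + d)) + d * d ≡ x * x + (x + d) * (x + d)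
  square = solve-∀
... | inj₂ y≤x = subst (λ x → 2 * (x * y) ≤ x * x + y * y) (m+[n∸m]≡n y≤x)
  (subst (2 * ((y + d) * y) ≤_) (square y d) (m≤m+n _ (d * d)))
  where
  d = x ∸ y
  square : ∀ y d → 2 * ((y + d) * y) + d * d ≡ (y + d) * (y + d) + y * y
  square = solve-∀

-- The tangent to x ↦ x ^ suc t at y, without subtraction.
bernoulli : ∀ t x y → suc t * (x * y ^ t) ≤ x ^ suc t + t * y ^ suc t
bernoulli zero x y = ≤-refl
-- The term added to both sides is the one that `x` times the induction hypothesis produces on the
-- right. It turns the left side into a multiple of `2 * (x * y)`.
bernoulli (suc t) x y = +-cancelʳ-≤ (x * (t * (y * y ^ t))) _ _ (begin
  suc (suc t) * (x * (y * p)) + x * (t * (y * p))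
    ≡⟨ regroup t x y p ⟩
  suc t * p * (2 * (x * y))
    ≤⟨ *-monoʳ-≤ (suc t * p) (2xy≤x²+y² x y) ⟩
  suc t * p * (x * x + y * y)
    ≡⟨ regroup′ t x y p ⟩
  x * (suc t * (x * p)) + suc t * (y * (y * p))
    ≤⟨ +-monoˡ-≤ _ (*-monoʳ-≤ x (bernoulli t x y)) ⟩
  x * (x ^ suc t + t * (y * p)) + suc t * (y * (y * p))
    ≡⟨ regroup″ t x y p (x ^ suc t) ⟩
  x * x ^ suc t + suc t * (y * (y * p)) + x * (t * (y * p)) ∎)
  where
  open ≤-Reasoning
  p = y ^ t
  regroup : ∀ t x y p → suc (suc t) * (x * (y * p)) + x * (t * (y * p)) ≡ suc t * p * (2 * (x * y))
  regroup = solve-∀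
  regroup′ : ∀ t x y p → suc t * p * (x * x + y * y) ≡ x * (suc t * (x * p)) + suc t * (y * (y * p))
  regroup′ = solve-∀
  regroup″ : ∀ t x y p q → x * (q + t * (y * p)) + suc t * (y * (y * p)) ≡ x * q + suc t * (y * (y * p)) + x * (t * (y * p))
  regroup″ = solve-∀

-- Elementary symmetric polynomials

^-distribʳ-* : ∀ r a b → (a * b) ^ r ≡ a ^ r * b ^ r
^-distribʳ-* zero    a b = refl
^-distribʳ-* (suc r) a b = trans (cong (a * b *_) (^-distribʳ-* r a b)) (interchange a b (a ^ r) (b ^ r))
  where open import Algebra.Properties.CommutativeSemigroup *-commutativeSemigroup using (interchange)

e : ℕ → Vec ℕ k → ℕ
e zero    m       = 1
e (suc r) []      = 0
e (suc r) (a ∷ m) = e (suc r) m + a * e r m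

e-0∷ : ∀ r (m : Vec ℕ k) → e r (0 ∷ m) ≡ e r m
e-0∷ zero    m = refl
e-0∷ (suc r) m = +-identityʳ (e (suc r) m)

-- `e` is affine in each entry, and its slope is the polynomial of one lower degree in the other
-- entries. Zeroing an entry deletes it while keeping the length.
e-increment : ∀ r (m : Vec ℕ k) j →
              e (suc r) (updateAt m j suc) ≡ e (suc r) m + e r (m [ j ]≔ 0)
e-increment r (a ∷ m) zero rewrite e-0∷ r m = regroup (e (suc r) m) a (e r m)
  where
  regroup : ∀ x a y → x + (y + a * y) ≡ x + a * y + y
  regroup = solve-∀
e-increment zero (a ∷ m) (suc j) rewrite e-increment zero m j =
  regroup (e 1 m) (a * 1)
  where
  regroup : ∀ x a → x + 1 + a ≡ x + a + 1
  regroup = solve-∀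
e-increment (suc r) (a ∷ m) (suc j)
  rewrite e-increment (suc r) m j | e-increment r m j =
  regroup (e (2 + r) m) (e (suc r) (m [ j ]≔ 0)) a (e (suc r) m) (e r (m [ j ]≔ 0))
  where
  regroup : ∀ x y a z u → x + y + a * (z + u) ≡ x + a * z + (y + a * u)
  regroup = solve-∀

-- A monomial of degree `r` survives the deletion of exactly the `k - r` entries that it avoids; the
-- `r` others are moved to the left to avoid subtraction.
∑-e-delete : ∀ r (m : Vec ℕ k) → ∑ (λ j → e r (m [ j ]≔ 0)) + r * e r m ≡ k * e r m
∑-e-delete zero [] = refl
∑-e-delete zero (a ∷ m) = cong suc (∑-e-delete zero m)
∑-e-delete (suc r) [] = *-zeroʳ r
∑-e-delete {suc k} (suc r) (a ∷ m) = begin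
  E₁ + 0 + ∑ (λ j → e (suc r) (m [ j ]≔ 0) + a * e r (m [ j ]≔ 0)) + suc r * (E₁ + a * E₀)
    ≡⟨ cong (λ x → E₁ + 0 + x + suc r * (E₁ + a * E₀)) (∑-distrib-+ (λ j → e (suc r) (m [ j ]≔ 0)) (λ j → a * e r (m [ j ]≔ 0))) ⟩
  E₁ + 0 + (S₁ + ∑ (λ j → a * e r (m [ j ]≔ 0))) + suc r * (E₁ + a * E₀)
    ≡⟨ cong (λ x → E₁ + 0 + (S₁ + x) + suc r * (E₁ + a * E₀)) (*-distribˡ-sum a (λ j → e r (m [ j ]≔ 0))) ⟨
  E₁ + 0 + (S₁ + a * S₀) + suc r * (E₁ + a * E₀)
    ≡⟨ regroup E₁ S₁ a S₀ r E₀ ⟩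
  E₁ + (S₁ + suc r * E₁) + a * (S₀ + r * E₀) + a * E₀
    ≡⟨ cong₂ (λ x y → E₁ + x + a * y + a * E₀) (∑-e-delete (suc r) m) (∑-e-delete r m) ⟩
  E₁ + k * E₁ + a * (k * E₀) + a * E₀
    ≡⟨ regroup′ E₁ k a E₀ ⟩
  suc k * (E₁ + a * E₀) ∎
  where
  open ≡-Reasoning
  E₁ = e (suc r) m
  E₀ = e r m
  S₁ = ∑ (λ j → e (suc r) (m [ j ]≔ 0))
  S₀ = ∑ (λ j → e r (m [ j ]≔ 0))
  regroup : ∀ E₁ S₁ a S₀ r E₀ → E₁ + 0 + (S₁ + a * S₀) + suc r * (E₁ + a * E₀) ≡ E₁ + (S₁ + suc r * E₁) + a * (S₀ + r * E₀) + a * E₀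
  regroup = solve-∀
  regroup′ : ∀ E₁ k a E₀ → E₁ + k * E₁ + a * (k * E₀) + a * E₀ ≡ suc k * (E₁ + a * E₀)
  regroup′ = solve-∀

-- This is `bernoulli` at the points `k * (a + s)` and `suc k * s`. They agree when the new entry
-- `a` equals the mean `s / k` of the others, which is the equality case of Maclaurin's inequality.
maclaurin-step : ∀ k t a s → t ≤ k →
                 (suc k * s) ^ t * ((k ∸ t) * s + suc t * a * k) ≤ (k * (a + s)) ^ suc t
maclaurin-step k t a s t≤k = +-cancelʳ-≤ (t * (K * s * y)) _ _ (begin
  y * (d * s + suc t * a * k) + t * (K * s * y)
    ≡⟨ cong (λ k → y * (d * s + suc t * a * k) + t * (suc k * s * y)) k≡ ⟩
  y * (d * s + suc t * a * (d + t)) + t * (suc (d + t) * s * y)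
    ≡⟨ regroup y d s t a ⟩
  suc t * ((d + t) * (a + s) * y)
    ≡⟨ cong (λ k → suc t * (k * (a + s) * y)) k≡ ⟨
  suc t * (k * (a + s) * y)
    ≤⟨ bernoulli t (k * (a + s)) (K * s) ⟩
  (k * (a + s)) ^ suc t + t * (K * s * y) ∎)
  where
  open ≤-Reasoning
  K = suc k
  d = k ∸ t
  y = (K * s) ^ t
  k≡ : k ≡ d + t
  k≡ = sym (m∸n+n≡m t≤k)
  regroup : ∀ y d s t a → y * (d * s + suc t * a * (d + t)) + t * (suc (d + t) * s * y) ≡ suc t * ((d + t) * (a + s) * y)
  regroup = solve-∀

-- e r m / (k C r) ≤ (sum m / k) ^ r, cleared of denominators by (k C r) * r ! ≡ k ^̲ r
maclaurin : ∀ r (m : Vec ℕ k) → k ^ r * r ! * e r m ≤ k ^̲ r * Vec.sum m ^ r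
maclaurin zero m = ≤-refl
maclaurin (suc t) [] = z≤n
-- A single entry is treated apart: the general case cancels a positive power of the number of
-- remaining entries, which is zero here.
maclaurin {1} 1 (a ∷ []) = ≤-reflexive (base a)
  where
  base : ∀ a → 1 * (a * 1) ≡ 1 * ((a + 0) * 1)
  base = solve-∀
maclaurin {1} (2+ t) (a ∷ []) = ≤-trans (≤-reflexive (begin-equality
  1 ^ (2+ t) * (2+ t) ! * (a * 0) ≡⟨ cong (1 ^ (2+ t) * (2+ t) ! *_) (*-zeroʳ a) ⟩
  1 ^ (2+ t) * (2+ t) ! * 0       ≡⟨ *-zeroʳ (1 ^ (2+ t) * (2+ t) !) ⟩
  0                             ∎)) z≤n
  where open ≤-Reasoning
maclaurin {suc k@(suc _)} (suc t) (a ∷ m) = *-cancelˡ-≤ (k ^ suc t) (begin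
  k ^ suc t * (K ^ suc t * suc t ! * (e (suc t) m + a * e t m))
    ≡⟨ regroup k (k ^ t) (K ^ suc t) t (t !) (e (suc t) m) a (e t m) ⟩
  K ^ suc t * (k ^ suc t * suc t ! * e (suc t) m + a * k * suc t * (k ^ t * t ! * e t m))
    ≤⟨ *-monoʳ-≤ (K ^ suc t) (+-mono-≤ (maclaurin (suc t) m) (*-monoʳ-≤ (a * k * suc t) (maclaurin t m))) ⟩
  K ^ suc t * (k ^̲ t * (k ∸ t) * s ^ suc t + a * k * suc t * (k ^̲ t * s ^ t))
    ≡⟨ regroup′ K (K ^ t) (k ^̲ t) (k ∸ t) s (s ^ t) a k t ⟩
  K * k ^̲ t * (K ^ t * s ^ t * ((k ∸ t) * s + suc t * a * k))
    ≤⟨ step ⟩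
  K * k ^̲ t * (k * (a + s)) ^ suc t
    ≡⟨ cong₂ _*_ (sym (^̲-suc k t)) (^-distribʳ-* (suc t) k (a + s)) ⟩
  K ^̲ suc t * (k ^ suc t * (a + s) ^ suc t)
    ≡⟨ x∙yz≈y∙xz (K ^̲ suc t) (k ^ suc t) ((a + s) ^ suc t) ⟩
  k ^ suc t * (K ^̲ suc t * (a + s) ^ suc t) ∎)
  where
  open ≤-Reasoning
  open import Algebra.Properties.CommutativeSemigroup *-commutativeSemigroup using (x∙yz≈y∙xz)
  K = suc k
  s = Vec.sum m
  instance
    _ : NonZero (k ^ suc t)
    _ = m^n≢0 k (suc t)
  step : K * k ^̲ t * (K ^ t * s ^ t * ((k ∸ t) * s + suc t * a * k)) ≤ K * k ^̲ t * (k * (a + s)) ^ suc t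
  step with ≤-<-connex t k
  ... | inj₁ t≤k = *-monoʳ-≤ (K * k ^̲ t)
    (subst (λ x → x * ((k ∸ t) * s + suc t * a * k) ≤ (k * (a + s)) ^ suc t)
           (^-distribʳ-* t K s) (maclaurin-step k t a s t≤k))
  -- Outside the range of `maclaurin-step` the common factor `k ^̲ t` is zero.
  ... | inj₂ k<t rewrite ^̲-vanish k<t | *-zeroʳ k = z≤n
  regroup : ∀ k kt Kt t f x a y → k * kt * (Kt * (suc t * f) * (x + a * y)) ≡ Kt * (k * kt * (suc t * f) * x + a * k * suc t * (kt * f * y))
  regroup = solve-∀
  regroup′ : ∀ K Kt g d s st a k t → K * Kt * (g * d * (s * st) + a * k * suc t * (g * st)) ≡ K * g * (Kt * st * (d * s + suc t * a * k))
  regroup′ = solve-∀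

-- Rainbow sets of a colouring

Colouring : ℕ → ℕ → Set
Colouring k n = Vec (Fin k) n

Rainbow : Colouring k n → Subset n → Set
Rainbow c p = ∀ i j → i Subset.∈ p → j Subset.∈ p → lookup c i ≡ lookup c j → i ≡ j

Allowed : Subset k → Colouring k n → Subset n → Set
Allowed w c p = ∀ i → i Subset.∈ p → lookup w (lookup c i) ≡ inside

-- The palette `w` holds the colours still available; selecting a vertex removes its colour.
-- Enumerating this way makes both the absence of repetitions and the count accessible to induction.
rainbowSets : Colouring k n → ℕ → Subset k → List (Subset n)
rainbowSets []      zero    w = [] ∷ˡ []ˡ
rainbowSets []      (suc r) w = []ˡ
rainbowSets (j ∷ c) zero    w = map (outside ∷_) (rainbowSets c zero w)
rainbowSets (j ∷ c) (suc r) w =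
  map (outside ∷_) (rainbowSets c (suc r) w) ++
  (if lookup w j then map (inside ∷_) (rainbowSets c r (w [ j ]≔ outside)) else []ˡ)

∈-rainbowSets⁺ : ∀ (c : Colouring k n) w p → Subset.∣ p ∣ ≡ r → Rainbow c p → Allowed w c p →
                 p ∈ˡ rainbowSets c r w
∈-rainbowSets⁺ [] w [] refl _ _ = here refl
∈-rainbowSets⁺ {r = zero} (j ∷ c) w (outside ∷ p) ∣p∣≡ rb al =
  ∈-map⁺ (outside ∷_) (∈-rainbowSets⁺ c w p ∣p∣≡
    (λ i i′ i∈ i′∈ eq → Fin.suc-injective (rb _ _ (there i∈) (there i′∈) eq)) (λ i → al (suc i) ∘ there))
∈-rainbowSets⁺ {r = suc r} (j ∷ c) w (outside ∷ p) ∣p∣≡ rb al =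
  ∈-++⁺ˡ (∈-map⁺ (outside ∷_) (∈-rainbowSets⁺ c w p ∣p∣≡
    (λ i i′ i∈ i′∈ eq → Fin.suc-injective (rb _ _ (there i∈) (there i′∈) eq)) (λ i → al (suc i) ∘ there)))
∈-rainbowSets⁺ (j ∷ c) w (inside ∷ p) refl rb al rewrite al zero here =
  ∈-++⁺ʳ _ (∈-map⁺ (inside ∷_) (∈-rainbowSets⁺ c (w [ j ]≔ outside) p refl
    (λ i i′ i∈ i′∈ eq → Fin.suc-injective (rb _ _ (there i∈) (there i′∈) eq))
    -- A later chosen vertex of colour `j` would share its colour with the chosen first vertex, so
    -- removing `j` from the palette affects none of the rest.
    (λ i i∈ → trans (lookup∘update′ {i = lookup c i} {j} (λ eq → Fin.0≢1+n (rb zero (suc i) here (there i∈) (sym eq))) w outside)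
                    (al (suc i) (there i∈)))))

∈-rainbowSets⁻ : ∀ (c : Colouring k n) r w p → p ∈ˡ rainbowSets c r w →
                 Subset.∣ p ∣ ≡ r × Rainbow c p × Allowed w c p
∈-rainbowSets⁻ [] zero w [] _ = refl , (λ ()) , (λ ())
∈-rainbowSets⁻ {k} {suc n} (j ∷ c) r w q q∈ = split r q∈
  where
  out : ∀ r {q} → q ∈ˡ map (outside ∷_) (rainbowSets c r w) → Subset.∣ q ∣ ≡ r × Rainbow (j ∷ c) q × Allowed w (j ∷ c) q
  out r q∈ with p , p∈ , refl ← ∈-map⁻ (outside ∷_) q∈ with ∣p∣≡ , rb , al ← ∈-rainbowSets⁻ c r w p p∈
    = ∣p∣≡ , rb′ , (λ { (suc i) (there i∈) → al i i∈ })
    where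
    rb′ : Rainbow (j ∷ c) (outside ∷ p)
    rb′ (suc i) (suc i′) (there i∈) (there i′∈) eq = cong suc (rb i i′ i∈ i′∈ eq)
  split : ∀ r {q} → q ∈ˡ rainbowSets (j ∷ c) r w → Subset.∣ q ∣ ≡ r × Rainbow (j ∷ c) q × Allowed w (j ∷ c) q
  split zero q∈ = out zero q∈
  split (suc r) q∈ with ∈-++⁻ (map (outside ∷_) (rainbowSets c (suc r) w)) q∈
  ... | inj₁ q∈ = out (suc r) q∈
  ... | inj₂ q∈ with lookup w j in wj
  ...   | true with p , p∈ , refl ← ∈-map⁻ (inside ∷_) q∈ with ∣p∣≡ , rb , al ← ∈-rainbowSets⁻ c r (w [ j ]≔ outside) p p∈
    = cong suc ∣p∣≡ , rb′ , al′
    where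
    new : ∀ i → i Subset.∈ p → lookup c i ≢ j
    new i i∈ refl with () ← trans (sym (lookup∘update (lookup c i) w outside)) (al i i∈)
    rb′ : Rainbow (j ∷ c) (inside ∷ p)
    rb′ zero    zero     _          _           _  = refl
    rb′ zero    (suc i′) _          (there i′∈) eq = contradiction (sym eq) (new i′ i′∈)
    rb′ (suc i) zero     (there i∈) _           eq = contradiction eq (new i i∈)
    rb′ (suc i) (suc i′) (there i∈) (there i′∈) eq = cong suc (rb i i′ i∈ i′∈ eq)
    al′ : Allowed w (j ∷ c) (inside ∷ p)
    al′ zero    _          = wj
    al′ (suc i) (there i∈) = trans (sym (lookup∘update′ (new i i∈) w outside)) (al i i∈)

rainbowSets-unique : ∀ (c : Colouring k n) r w → Unique (rainbowSets c r w)
rainbowSets-unique []      zero    w = All.[] ∷ᵘ []ᵘ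
rainbowSets-unique []      (suc r) w = []ᵘ
rainbowSets-unique (j ∷ c) zero    w = Unique.map⁺ ∷-injectiveʳ (rainbowSets-unique c zero w)
rainbowSets-unique (j ∷ c) (suc r) w =
  Unique.++⁺ (Unique.map⁺ ∷-injectiveʳ (rainbowSets-unique c (suc r) w)) (right (lookup w j)) (disjoint (lookup w j))
  where
  right : ∀ b → Unique (if b then map (inside ∷_) (rainbowSets c r (w [ j ]≔ outside)) else []ˡ)
  right true  = Unique.map⁺ ∷-injectiveʳ (rainbowSets-unique c r (w [ j ]≔ outside))
  right false = []ᵘ
  disjoint : ∀ b → Disjoint (map (outside ∷_) (rainbowSets c (suc r) w))
                            (if b then map (inside ∷_) (rainbowSets c r (w [ j ]≔ outside)) else []ˡ)
  disjoint true (v∈₁ , v∈₂)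
    with _ , _ , refl ← ∈-map⁻ (outside ∷_) v∈₁ | _ , _ , () ← ∈-map⁻ (inside ∷_) v∈₂

length-rainbowSets≤C : ∀ (c : Colouring k n) r w → length (rainbowSets c r w) ≤ n C r
length-rainbowSets≤C []      zero    w = ≤-refl
length-rainbowSets≤C []      (suc r) w = z≤n
length-rainbowSets≤C (j ∷ c) zero    w rewrite length-map (outside ∷_) (rainbowSets c zero w) =
  length-rainbowSets≤C c zero w
length-rainbowSets≤C {n = suc n} (j ∷ c) (suc r) w = begin
  length (xs ++ ys (lookup w j))          ≡⟨ length-++ xs ⟩
  length xs + length (ys (lookup w j))    ≤⟨ +-mono-≤ left (right (lookup w j)) ⟩
  (n C suc r) + (n C r)                   ≡⟨ +-comm (n C suc r) (n C r) ⟩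
  (n C r) + (n C suc r)                   ≡⟨ nCk+nC[k+1]≡[n+1]C[k+1] n r ⟩
  suc n C suc r                           ∎
  where
  open ≤-Reasoning
  xs = map (outside ∷_) (rainbowSets c (suc r) w)
  ys = λ (b : Bool) → if b then map (inside ∷_) (rainbowSets c r (w [ j ]≔ outside)) else []ˡ
  left : length xs ≤ n C suc r
  left rewrite length-map (outside ∷_) (rainbowSets c (suc r) w) = length-rainbowSets≤C c (suc r) w
  right : ∀ b → length (ys b) ≤ n C r
  right true rewrite length-map (inside ∷_) (rainbowSets c r (w [ j ]≔ outside)) = length-rainbowSets≤C c r (w [ j ]≔ outside)
  right false = z≤n

-- Colours outside `w` count as empty classes, so that shrinking the palette in `rainbowSets`
-- amounts to zeroing an entry.
classSizes : Subset k → Colouring k n → Vec ℕ k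
classSizes w []      = replicate _ 0
classSizes w (j ∷ c) = if lookup w j then updateAt (classSizes w c) j suc else classSizes w c

classSizes-delete : ∀ (w : Subset k) (c : Colouring k n) j →
                    classSizes (w [ j ]≔ outside) c ≡ classSizes w c [ j ]≔ 0
classSizes-delete w [] j = go j
  where
  go : ∀ {k} (j : Fin k) → replicate k 0 ≡ replicate k 0 [ j ]≔ 0
  go zero    = refl
  go (suc j) = cong (0 ∷_) (go j)
classSizes-delete w (i ∷ c) j with i Fin.≟ j
... | yes refl rewrite lookup∘update i w outside with lookup w i
...   | true  = trans (classSizes-delete w c i) (sym (updateAt-updateAt i (classSizes w c)))
...   | false = classSizes-delete w c i
classSizes-delete w (i ∷ c) j | no i≢j rewrite lookup∘update′ i≢j w outside with lookup w i
...   | true  = trans (cong (λ m → updateAt m i suc) (classSizes-delete w c j))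
                      (updateAt-commutes i j i≢j (classSizes w c))
...   | false = classSizes-delete w c j

e-empty : ∀ r k → e (suc r) (replicate k 0) ≡ 0
e-empty r zero    = refl
e-empty r (suc k) = trans (+-identityʳ (e (suc r) (replicate k 0))) (e-empty r k)

-- A rainbow set either omits the first vertex or combines it with a smaller one avoiding its
-- colour. The counts thus obey the recurrence `e-increment`.
length-rainbowSets : ∀ (c : Colouring k n) r w → length (rainbowSets c r w) ≡ e r (classSizes w c)
length-rainbowSets []      zero    w = refl
length-rainbowSets {k} []  (suc r) w = sym (e-empty r k)
length-rainbowSets (j ∷ c) zero    w =
  trans (length-map (outside ∷_) (rainbowSets c zero w)) (length-rainbowSets c zero w)
length-rainbowSets (j ∷ c) (suc r) w
  rewrite length-++ (map (outside ∷_) (rainbowSets c (suc r) w))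
                    {if lookup w j then map (inside ∷_) (rainbowSets c r (w [ j ]≔ outside)) else []ˡ}
        | length-map (outside Vec.∷_) (rainbowSets c (suc r) w)
        | length-rainbowSets c (suc r) w
  with lookup w j
... | false = +-identityʳ _
... | true
  rewrite length-map (inside Vec.∷_) (rainbowSets c r (w [ j ]≔ outside))
        | length-rainbowSets c r (w [ j ]≔ outside)
        | classSizes-delete w c j = sym (e-increment r (classSizes w c) j)

sum-classSizes : ∀ (w : Subset k) (c : Colouring k n) → Vec.sum (classSizes w c) ≤ n
sum-classSizes {k} w [] = ≤-reflexive (go k)
  where
  go : ∀ k → Vec.sum (replicate k 0) ≡ 0
  go zero    = refl
  go (suc k) = go k
sum-classSizes w (j ∷ c) with lookup w j
... | true  = ≤-trans (≤-reflexive (go (classSizes w c) j)) (s≤s (sum-classSizes w c))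
  where
  go : ∀ {k} (m : Vec ℕ k) j → Vec.sum (updateAt m j suc) ≡ suc (Vec.sum m)
  go (a ∷ m) zero    = refl
  go (a ∷ m) (suc j) = trans (cong (a +_) (go m j)) (+-suc a (Vec.sum m))
... | false = m≤n⇒m≤1+n (sum-classSizes w c)

-- The family of graphs without a rainbow colouring

lookup-injective : ∀ {a} {A : Set a} {xs : List A} → Unique xs → ∀ i j → List.lookup xs i ≡ List.lookup xs j → i ≡ j
lookup-injective (_   ∷ᵘ _)   zero    zero    _  = refl
lookup-injective (x∉  ∷ᵘ _)   zero    (suc j) eq = contradiction eq (All.lookup x∉ (∈-lookup j))
lookup-injective (x∉  ∷ᵘ _)   (suc i) zero    eq = contradiction (sym eq) (All.lookup x∉ (∈-lookup i))
lookup-injective (_   ∷ᵘ xs!) (suc i) (suc j) eq = cong suc (lookup-injective xs! i j eq)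

length-⊆ : ∀ {a} {A : Set a} {xs ys : List A} → Unique xs → (∀ {x} → x ∈ˡ xs → x ∈ˡ ys) → length xs ≤ length ys
length-⊆ {xs = xs} {ys} xs! xs⊆ys = Fin.injective⇒≤ position-injective
  where
  member-at : ∀ i → List.lookup xs i ∈ˡ ys
  member-at i = xs⊆ys (∈-lookup i)
  position-injective : ∀ {i j} → Any.index (member-at i) ≡ Any.index (member-at j) → i ≡ j
  position-injective {i} {j} eq = lookup-injective xs! i j
    (trans (lookup-index (member-at i)) (trans (cong (List.lookup ys) eq) (sym (lookup-index (member-at j)))))

Proper : Colouring k n → RGraph r n → Set
Proper c G = ∀ p → p ∈ˡ edges G → Rainbow c p

allColours : ∀ k → Subset k
allColours k = replicate k inside

everyAllowed : ∀ (c : Colouring k n) p → Allowed (allColours k) c p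
everyAllowed c p i _ = lookup-replicate (lookup c i) inside

rainbowGraph : Colouring k n → ∀ r → RGraph r n
rainbowGraph {k} c r = record
  { edges   = rainbowSets c r (allColours k)
  ; unique  = rainbowSets-unique c r (allColours k)
  ; uniform = All.tabulate λ {p} p∈ → proj₁ (∈-rainbowSets⁻ c r (allColours k) p p∈)
  }

rainbowGraph-proper : ∀ (c : Colouring k n) r → Proper c (rainbowGraph c r)
rainbowGraph-proper {k} c r p p∈ = proj₁ (proj₂ (∈-rainbowSets⁻ c r (allColours k) p p∈))

size≤rainbowGraph : ∀ (c : Colouring k n) (G : RGraph r n) → Proper c G → size G ≤ size (rainbowGraph c r)
size≤rainbowGraph {k} c G proper = length-⊆ (unique G) λ {p} p∈ →
  ∈-rainbowSets⁺ c (allColours k) p (All.lookup (uniform G) p∈) (proper p p∈) (everyAllowed c p)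

size≤C : ∀ (G : RGraph r n) → size G ≤ n C r
size≤C {r} {n} G = ≤-trans (size≤rainbowGraph c G injective) (length-rainbowSets≤C c r (allColours n))
  where
  -- When every vertex has its own colour, every graph is properly coloured.
  c = Vec.allFin n
  injective : Proper c G
  injective p _ i j _ _ eq = trans (sym (lookup∘tabulate _ i)) (trans eq (lookup∘tabulate _ j))

∈-image⁺ : ∀ {m n} (f : Fin m → Fin n) {p i} → i Subset.∈ p → f i Subset.∈ image f p
∈-image⁺ f {p} {i} i∈p = lookup⇒[]= (f i) _ (trans (lookup∘tabulate _ (f i)) (dec-true (Fin.any? λ i′ → (i′ ∈? p) ×-dec (f i′ Fin.≟ f i)) (i , i∈p , refl)))

-- The colouring is pulled back along the embedding; injectivity carries the equality of image
-- vertices back to the subgraph.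
proper-subgraph : ∀ {m n} {F : RGraph r m} {G : RGraph r n} → F IsSubgraphOf G →
                  ∀ (c : Colouring k n) → Proper c G → ∃[ c′ ] Proper {k} c′ F
proper-subgraph (f , f-inj , edge) c proper = tabulate (lookup c ∘ f) , λ p p∈ i j i∈ j∈ eq →
  f-inj (proper (image f p) (edge p p∈) (f i) (f j) (∈-image⁺ f i∈) (∈-image⁺ f j∈)
    (trans (sym (lookup∘tabulate _ i)) (trans eq (lookup∘tabulate _ j))))

image-id : ∀ {n} (p : Subset n) → image (λ i → i) p ≡ p
image-id p = trans (Vec.tabulate-cong pointwise) (Vec.tabulate∘lookup p)
  where
  pointwise : ∀ j → does (Fin.any? λ i → (i ∈? p) ×-dec (i Fin.≟ j)) ≡ lookup p j
  pointwise j with lookup p j in pj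
  ... | true  = dec-true (Fin.any? λ i → (i ∈? p) ×-dec (i Fin.≟ j)) (j , lookup⇒[]= j p pj , refl)
  ... | false = dec-false (Fin.any? λ i → (i ∈? p) ×-dec (i Fin.≟ j))
    λ { (_ , j∈p , refl) → contradiction (trans (sym ([]=⇒lookup j∈p)) pj) λ () }

-- Lets an uncolourable graph serve as a forbidden subgraph of itself.
subgraph-refl : ∀ (G : RGraph r n) → G IsSubgraphOf G
subgraph-refl G = (λ i → i) , (λ eq → eq) , λ p p∈ → subst (_∈ˡ edges G) (sym (image-id p)) p∈

-- Maxima and averages over all colourings

argmax-Fin : ∀ (f : Fin (suc k) → ℕ) → ∃[ i ] (∀ j → f j ≤ f i)
argmax-Fin {zero}  f = zero , λ { zero → ≤-refl }
argmax-Fin {suc k} f with i , max ← argmax-Fin (f ∘ suc) with ≤-total (f zero) (f (suc i))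
... | inj₁ f0≤ = suc i , λ { zero → f0≤ ; (suc j) → max j }
... | inj₂ ≤f0 = zero , λ { zero → ≤-refl ; (suc j) → ≤-trans (max j) ≤f0 }

argmax : ∀ {k n} (f : Colouring (suc k) n → ℕ) → ∃[ c ] (∀ c′ → f c′ ≤ f c)
argmax {n = zero}  f = [] , λ { [] → ≤-refl }
argmax {n = suc n} f with j , max ← argmax-Fin (λ j → f (j ∷ proj₁ (argmax (f ∘ (j ∷_)))))
  = j ∷ proj₁ (argmax (f ∘ (j ∷_))) , λ { (i ∷ c) → ≤-trans (proj₂ (argmax (f ∘ (i ∷_))) c) (max i) }

-- The colour of the first vertex is summed innermost, so that `e-average-step` bounds the inner sum
-- for each fixed tail.
∑ᶜ : (Colouring k n → ℕ) → ℕ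
∑ᶜ {n = zero}  f = f []
∑ᶜ {n = suc n} f = ∑ᶜ λ c → ∑ λ j → f (j ∷ c)

∑-mono : ∀ {f g : Fin k → ℕ} → (∀ j → f j ≤ g j) → ∑ f ≤ ∑ g
∑-mono {zero}  f≤g = z≤n
∑-mono {suc k} f≤g = +-mono-≤ (f≤g zero) (∑-mono (f≤g ∘ suc))

∑-const : ∀ k a → ∑ {k} (λ _ → a) ≡ k * a
∑-const zero    a = refl
∑-const (suc k) a = cong (a +_) (∑-const k a)

∑ᶜ-mono : ∀ {f g : Colouring k n → ℕ} → (∀ c → f c ≤ g c) → ∑ᶜ f ≤ ∑ᶜ g
∑ᶜ-mono {n = zero}  f≤g = f≤g []
∑ᶜ-mono {n = suc n} f≤g = ∑ᶜ-mono λ c → ∑-mono λ j → f≤g (j ∷ c)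

∑ᶜ-linear : ∀ a b (f g : Colouring k n → ℕ) → ∑ᶜ (λ c → a * f c + b * g c) ≡ a * ∑ᶜ f + b * ∑ᶜ g
∑ᶜ-linear {n = zero}  a b f g = refl
∑ᶜ-linear {k} {suc n} a b f g = trans
  -- Pointwise equality does not give equality of functions, so it passes through `∑ᶜ` as two
  -- inequalities.
  (≤-antisym (∑ᶜ-mono λ c → ≤-reflexive (inner c)) (∑ᶜ-mono λ c → ≤-reflexive (sym (inner c))))
  (∑ᶜ-linear a b (λ c → ∑ λ j → f (j ∷ c)) (λ c → ∑ λ j → g (j ∷ c)))
  where
  inner : ∀ (c : Colouring k n) → ∑ (λ j → a * f (j ∷ c) + b * g (j ∷ c)) ≡ a * ∑ (λ j → f (j ∷ c)) + b * ∑ (λ j → g (j ∷ c))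
  inner c = trans (∑-distrib-+ (λ j → a * f (j ∷ c)) (λ j → b * g (j ∷ c)))
                  (sym (cong₂ _+_ (*-distribˡ-sum a (λ j → f (j ∷ c))) (*-distribˡ-sum b (λ j → g (j ∷ c)))))

∑ᶜ-const : ∀ k n a → ∑ᶜ {k} {n} (λ _ → a) ≡ k ^ n * a
∑ᶜ-const k zero    a = sym (+-identityʳ a)
∑ᶜ-const k (suc n) a rewrite ∑-const k a | ∑ᶜ-const k n (k * a) = regroup k (k ^ n) a
  where
  regroup : ∀ k p a → p * (k * a) ≡ k * p * a
  regroup = solve-∀

∑ᶜ-upper : ∀ {f : Colouring k n → ℕ} {a} → (∀ c → f c ≤ a) → ∑ᶜ f ≤ k ^ n * a
∑ᶜ-upper {k} {n} {a = a} f≤a = ≤-trans (∑ᶜ-mono f≤a) (≤-reflexive (∑ᶜ-const k n a))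

-- A new vertex of colour `j` extends the rainbow `r`-sets that avoid class `j`. Summed over `j`,
-- each rainbow `r`-set is counted once for every colour it misses.
e-average-step : ∀ r (c : Colouring k n) →
  k * e (suc r) (classSizes (allColours k) c) + (k ∸ r) * e r (classSizes (allColours k) c)
    ≤ ∑ λ j → e (suc r) (classSizes (allColours k) (j ∷ c))
e-average-step {k} r c = begin
  k * e (suc r) m + (k ∸ r) * e r m
    ≤⟨ +-monoʳ-≤ (k * e (suc r) m) delete ⟩
  k * e (suc r) m + ∑ (λ j → e r (m [ j ]≔ 0))
    ≡⟨ cong (_+ ∑ (λ j → e r (m [ j ]≔ 0))) (∑-const k (e (suc r) m)) ⟨
  ∑ {k} (λ _ → e (suc r) m) + ∑ (λ j → e r (m [ j ]≔ 0))
    ≡⟨ ∑-distrib-+ {k} (λ _ → e (suc r) m) (λ j → e r (m [ j ]≔ 0)) ⟨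
  ∑ (λ j → e (suc r) m + e r (m [ j ]≔ 0))
    ≡⟨ sum-cong-≗ increment ⟨
  ∑ (λ j → e (suc r) (classSizes (allColours k) (j ∷ c))) ∎
  where
  open ≤-Reasoning
  m = classSizes (allColours k) c
  delete : (k ∸ r) * e r m ≤ ∑ (λ j → e r (m [ j ]≔ 0))
  delete = begin
    (k ∸ r) * e r m
      ≡⟨ *-distribʳ-∸ (e r m) k r ⟩
    k * e r m ∸ r * e r m
      ≡⟨ cong (_∸ r * e r m) (∑-e-delete r m) ⟨
    (∑ (λ j → e r (m [ j ]≔ 0)) + r * e r m) ∸ r * e r m
      ≡⟨ m+n∸n≡m _ (r * e r m) ⟩
    ∑ (λ j → e r (m [ j ]≔ 0)) ∎
  increment : ∀ j → e (suc r) (classSizes (allColours k) (j ∷ c)) ≡ e (suc r) m + e r (m [ j ]≔ 0)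
  increment j rewrite lookup-replicate j inside = e-increment r m j

-- A fixed `r`-set is rainbow with probability `k ^̲ r / k ^ r` under a uniformly random colouring,
-- so this bounds the expected number of rainbow sets, cleared of denominators. The induction
-- follows Pascal's rule.
e-average : ∀ k n r → (n C r) * (k ^ n * k ^̲ r) ≤ k ^ r * ∑ᶜ {k} {n} (λ c → e r (classSizes (allColours k) c))
e-average k n zero rewrite ∑ᶜ-const k n 1 = ≤-refl
e-average k zero (suc r) rewrite k>n⇒nCk≡0 {0} {suc r} z<s = z≤n
e-average k (suc n) (suc r) = begin
  (suc n C suc r) * (k * k ^ n * (k ^̲ r * (k ∸ r)))
    ≡⟨ cong (_* (k * k ^ n * (k ^̲ r * (k ∸ r)))) (nCk+nC[k+1]≡[n+1]C[k+1] n r) ⟨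
  ((n C r) + (n C suc r)) * (k * k ^ n * (k ^̲ r * (k ∸ r)))
    ≡⟨ regroup (n C r) (n C suc r) k (k ^ n) (k ^̲ r) (k ∸ r) ⟩
  k * ((n C suc r) * (k ^ n * (k ^̲ r * (k ∸ r)))) + k * (k ∸ r) * ((n C r) * (k ^ n * k ^̲ r))
    ≤⟨ +-mono-≤ (*-monoʳ-≤ k (e-average k n (suc r))) (*-monoʳ-≤ (k * (k ∸ r)) (e-average k n r)) ⟩
  k * (k * k ^ r * S₁) + k * (k ∸ r) * (k ^ r * S₀)
    ≡⟨ regroup′ k (k ^ r) S₁ (k ∸ r) S₀ ⟩
  k * k ^ r * (k * S₁ + (k ∸ r) * S₀)
    ≡⟨ cong (k * k ^ r *_) (∑ᶜ-linear {k} {n} k (k ∸ r) (e (suc r) ∘ m) (e r ∘ m)) ⟨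
  k * k ^ r * ∑ᶜ {k} {n} (λ c → k * e (suc r) (m c) + (k ∸ r) * e r (m c))
    ≤⟨ *-monoʳ-≤ (k * k ^ r) (∑ᶜ-mono {k} {n} (e-average-step r)) ⟩
  k * k ^ r * ∑ᶜ {k} {n} (λ c → ∑ λ j → e (suc r) (m (j ∷ c))) ∎
  where
  open ≤-Reasoning
  m : ∀ {n} → Colouring k n → Vec ℕ k
  m = classSizes (allColours k)
  S₁ = ∑ᶜ {k} {n} (e (suc r) ∘ m)
  S₀ = ∑ᶜ {k} {n} (e r ∘ m)
  regroup : ∀ c₀ c₁ k p f d → (c₀ + c₁) * (k * p * (f * d)) ≡ k * (c₁ * (p * (f * d))) + k * d * (c₀ * (p * f))
  regroup = solve-∀
  regroup′ : ∀ k p s₁ d s₀ → k * (k * p * s₁) + k * d * (p * s₀) ≡ k * p * (k * s₁ + d * s₀)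
  regroup′ = solve-∀

-- Turán numbers of the uncolourable graphs

module Turán (k-1 r : ℕ) where

  private K = suc k-1

  uncolourable : Family r
  uncolourable = record
    { member  = λ G → ¬ (∃[ c ] Proper {K} c G)
    -- A constant colouring is proper for an edgeless graph, so no such graph is a member.
    ; hasEdge = λ F ¬colourable → n≢0⇒n>0 λ size≡0 →
        ¬colourable (replicate _ zero , λ p p∈ → contradiction (subst (0 <_) size≡0 (∈-length p∈)) λ ())
    }

  colourable⇒free : ∀ {n} (c : Colouring K n) (G : RGraph r n) → Proper c G → Free uncolourable G
  colourable⇒free c G proper F ¬colourable F⊆G = ¬colourable (proper-subgraph {F = F} {G} F⊆G c proper)

  optimal : ∀ n → ∃[ c ] (∀ c′ → size (rainbowGraph c′ r) ≤ size (rainbowGraph {K} {n} c r))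
  optimal n = argmax λ c → size (rainbowGraph c r)

  ex : ℕ → ℕ
  ex n = size (rainbowGraph (proj₁ (optimal n)) r)

  isEx : ∀ n → IsEx uncolourable n (ex n)
  isEx n = (G , colourable⇒free c G (rainbowGraph-proper c r) , refl) ,
    -- Freeness only shows that `H` is not uncolourable. This suffices because the bound on its size
    -- is decidable: if it failed, `H` would be uncolourable and contain itself.
    λ H free → decidable-stable (size H ≤? ex n) λ size≰ →
      free H (λ (c′ , proper) → size≰ (≤-trans (size≤rainbowGraph c′ H proper) (proj₂ (optimal n) c′))) (subgraph-refl H)
    where
    c = proj₁ (optimal n)
    G = rainbowGraph c r

  -- The maximum over all colourings is at least the average.
  ex-lower : ∀ n → (n C r) * K ^̲ r ≤ ex n * K ^ r
  ex-lower n = *-cancelˡ-≤ (K ^ n) {{m^n≢0 K n}} (begin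
    K ^ n * ((n C r) * K ^̲ r)
      ≡⟨ x∙yz≈y∙xz (K ^ n) (n C r) (K ^̲ r) ⟩
    (n C r) * (K ^ n * K ^̲ r)
      ≤⟨ e-average K n r ⟩
    K ^ r * ∑ᶜ {K} {n} (λ c → e r (classSizes (allColours K) c))
      ≤⟨ *-monoʳ-≤ (K ^ r) (∑ᶜ-upper {K} {n} λ c →
           ≤-trans (≤-reflexive (sym (length-rainbowSets c r (allColours K)))) (proj₂ (optimal n) c)) ⟩
    K ^ r * (K ^ n * ex n)
      ≡⟨ regroup (K ^ r) (K ^ n) (ex n) ⟩
    K ^ n * (ex n * K ^ r) ∎)
    where
    open ≤-Reasoning
    open import Algebra.Properties.CommutativeSemigroup *-commutativeSemigroup using (x∙yz≈y∙xz)
    regroup : ∀ p q x → p * (q * x) ≡ q * (x * p)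
    regroup = solve-∀

  -- Maclaurin's inequality at the class sizes of an optimal colouring.
  ex-upper : ∀ n → K ^ r * r ! * ex n ≤ K ^̲ r * n ^ r
  ex-upper n = begin
    K ^ r * r ! * ex n            ≡⟨ cong (K ^ r * r ! *_) (length-rainbowSets c r (allColours K)) ⟩
    K ^ r * r ! * e r m           ≤⟨ maclaurin r m ⟩
    K ^̲ r * Vec.sum m ^ r         ≤⟨ *-monoʳ-≤ (K ^̲ r) (^-monoˡ-≤ r (sum-classSizes (allColours K) c)) ⟩
    K ^̲ r * n ^ r                 ∎
    where
    open ≤-Reasoning
    c = proj₁ (optimal n)
    m = classSizes (allColours K) c

-- Approximation of rationals by densities

ratio-≤ : ∀ a b c d → 0 < b → 0 < d → a * d ≤ c * b → ratio a b ℚ.≤ ratio c d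
ratio-≤ a (suc b) c (suc d) _ _ ad≤cb = ℚ.toℚᵘ-cancel-≤ (begin
  ℚ.toℚᵘ (ℤ.+ a ℚ./ suc b) ≃⟨ ℚ.toℚᵘ-fromℚᵘ (mkℚᵘ (ℤ.+ a) b) ⟩
  mkℚᵘ (ℤ.+ a) b           ≤⟨ ℚᵘ.*≤* (subst₂ ℤ._≤_ (ℤ.pos-* a (suc d)) (ℤ.pos-* c (suc b)) (ℤ.+≤+ ad≤cb)) ⟩
  mkℚᵘ (ℤ.+ c) d           ≃⟨ ℚ.toℚᵘ-fromℚᵘ (mkℚᵘ (ℤ.+ c) d) ⟨
  ℚ.toℚᵘ (ℤ.+ c ℚ./ suc d) ∎)
  where open ℚᵘ.≤-Reasoning

ratio-+ : ∀ a b c d → 0 < b → 0 < d → ratio a b ℚ.+ ratio c d ≡ ratio (a * d + c * b) (b * d)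
ratio-+ a (suc b) c (suc d) _ _ = ℚ.toℚᵘ-injective (begin
  ℚ.toℚᵘ (p ℚ.+ q)                              ≈⟨ ℚ.toℚᵘ-homo-+ p q ⟩
  ℚ.toℚᵘ p ℚᵘ.+ ℚ.toℚᵘ q                        ≈⟨ ℚᵘ.+-cong (ℚ.toℚᵘ-fromℚᵘ (mkℚᵘ (ℤ.+ a) b)) (ℚ.toℚᵘ-fromℚᵘ (mkℚᵘ (ℤ.+ c) d)) ⟩
  mkℚᵘ (ℤ.+ a ℤ.* ℤ.+ suc d ℤ.+ ℤ.+ c ℤ.* ℤ.+ suc b) bd ≡⟨ cong (λ i → mkℚᵘ i bd) numerator ⟩
  mkℚᵘ (ℤ.+ (a * suc d + c * suc b)) bd           ≈⟨ ℚ.toℚᵘ-fromℚᵘ (mkℚᵘ (ℤ.+ (a * suc d + c * suc b)) bd) ⟨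
  ℚ.toℚᵘ (ratio (a * suc d + c * suc b) (suc b * suc d)) ∎)
  where
  open import Relation.Binary.Reasoning.Setoid ℚᵘ.≃-setoid
  p = ℤ.+ a ℚ./ suc b
  q = ℤ.+ c ℚ./ suc d
  bd = d + b * suc d
  numerator : ℤ.+ a ℤ.* ℤ.+ suc d ℤ.+ ℤ.+ c ℤ.* ℤ.+ suc b ≡ ℤ.+ (a * suc d + c * suc b)
  numerator = trans (cong₂ ℤ._+_ (sym (ℤ.pos-* a (suc d))) (sym (ℤ.pos-* c (suc b)))) (sym (ℤ.pos-+ (a * suc d) (c * suc b)))

ratio-≤-+ : ∀ a b c d e f → 0 < b → 0 < d → 0 < f →
            a * (d * f) ≤ (c * f + e * d) * b → ratio a b ℚ.≤ ratio c d ℚ.+ ratio e f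
ratio-≤-+ a b c d e f 0<b 0<d 0<f h = subst (ratio a b ℚ.≤_) (sym (ratio-+ c d e f 0<d 0<f))
  (ratio-≤ a b (c * f + e * d) (d * f) 0<b (*-mono-≤ 0<d 0<f) h)

0≤ratio : ∀ a b → 0ℚ ℚ.≤ ratio a b
0≤ratio a zero    = ℚ.≤-refl
0≤ratio a (suc b) = ratio-≤ 0 1 a (suc b) z<s z<s z≤n

ratio≤1 : ∀ {a b} → a ≤ b → ratio a b ℚ.≤ 1ℚ
ratio≤1 {a} {zero}  a≤b = 0≤ratio 1 1
ratio≤1 {a} {suc b} a≤b = ratio-≤ a (suc b) 1 1 z<s z<s (subst₂ _≤_ (sym (*-identityʳ a)) (sym (+-identityʳ (suc b))) a≤b)

unit : ℕ → ℚ
unit M = ratio 1 (suc M)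

-- A linear inequality follows from a combination x ≤ y of known ones once b - a ≡ y - x.
≤-by : ∀ {x y a b} → x ℚ.≤ y → y ℚ.- x ≡ b ℚ.- a → a ℚ.≤ b
≤-by {x} {y} {a} {b} x≤y eq = begin
  a                     ≡⟨ solve 2 (λ a x → a := x :+ (a :- x)) refl a x ⟩
  x ℚ.+ (a ℚ.- x)       ≤⟨ ℚ.+-monoˡ-≤ (a ℚ.- x) x≤y ⟩
  y ℚ.+ (a ℚ.- x)       ≡⟨ solve 3 (λ a x y → y :+ (a :- x) := a :+ (y :- x)) refl a x y ⟩
  a ℚ.+ (y ℚ.- x)       ≡⟨ cong (a ℚ.+_) eq ⟩
  a ℚ.+ (b ℚ.- a)       ≡⟨ solve 2 (λ a b → a :+ (b :- a) := b) refl a b ⟩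
  b                     ∎
  where open ℚ.≤-Reasoning

infix 4 _≈[_]_
-- Two inequalities instead of an absolute value, so that estimates combine linearly through `≤-by`.
_≈[_]_ : ℚ → ℚ → ℚ → Set
a ≈[ u ] b = a ℚ.≤ b ℚ.+ u × b ℚ.≤ a ℚ.+ u

≈⇒∣-∣≤ : ∀ {a b u} → a ≈[ u ] b → ℚ.∣ a ℚ.- b ∣ ℚ.≤ u
≈⇒∣-∣≤ {a} {b} {u} (a≤ , b≤) with ℚ.∣p∣≡p∨∣p∣≡-p (a ℚ.- b)
... | inj₁ eq rewrite eq = ≤-by a≤ (solve 3 (λ a b u → (b :+ u) :- a := u :- (a :- b)) refl a b u)
... | inj₂ eq rewrite eq = ≤-by b≤ (solve 3 (λ a b u → (a :+ u) :- b := u :- :- (a :- b)) refl a b u)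

p≤∣p∣ : ∀ p → p ℚ.≤ ℚ.∣ p ∣
p≤∣p∣ p with ℚ.≤-total 0ℚ p
... | inj₁ 0≤p = ℚ.≤-reflexive (sym (ℚ.0≤p⇒∣p∣≡p 0≤p))
... | inj₂ p≤0 = ℚ.≤-trans p≤0 (ℚ.0≤∣p∣ p)

∣-∣≤⇒≈ : ∀ {a b u} → ℚ.∣ a ℚ.- b ∣ ℚ.≤ u → a ≈[ u ] b
∣-∣≤⇒≈ {a} {b} {u} h =
  ≤-by (ℚ.≤-trans (p≤∣p∣ (a ℚ.- b)) h) (solve 3 (λ a b u → u :- (a :- b) := (b :+ u) :- a) refl a b u) ,
  ≤-by (ℚ.≤-trans (p≤∣p∣ (ℚ.- (a ℚ.- b))) (subst (ℚ._≤ u) (sym (ℚ.∣-p∣≡∣p∣ (a ℚ.- b))) h))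
       (solve 3 (λ a b u → u :- :- (a :- b) := (a :+ u) :- b) refl a b u)

≈-trans : ∀ {a b c u v} → a ≈[ u ] b → b ≈[ v ] c → a ≈[ u ℚ.+ v ] c
≈-trans {a} {b} {c} {u} {v} (a≤b , b≤a) (b≤c , c≤b) =
  ≤-by (ℚ.+-mono-≤ a≤b b≤c) (solve 5 (λ a b c u v → ((b :+ u) :+ (c :+ v)) :- (a :+ b) := (c :+ (u :+ v)) :- a) refl a b c u v) ,
  ≤-by (ℚ.+-mono-≤ b≤a c≤b) (solve 5 (λ a b c u v → ((a :+ u) :+ (b :+ v)) :- (b :+ c) := (a :+ (u :+ v)) :- c) refl a b c u v)

half : ∀ {δ} → 0ℚ ℚ.< δ → ∃[ η ] (0ℚ ℚ.< η × η ℚ.+ η ≡ δ)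
half {δ} 0<δ = ½ ℚ.* δ , subst (ℚ._< ½ ℚ.* δ) (ℚ.*-zeroʳ ½) (ℚ.*-monoʳ-<-pos ½ 0<δ) ,
  trans (sym (ℚ.*-distribʳ-+ δ ½ ½)) (ℚ.*-identityˡ δ)

0<unit : ∀ M → 0ℚ ℚ.< unit M
0<unit M = ℚ.positive⁻¹ (unit M) {{ℚ.normalize-pos 1 (suc M) {{_}} {{_}}}}

-- A positive rational is at least the reciprocal of its own denominator.
unit≤ : ∀ {δ} → 0ℚ ℚ.< δ → ∃[ M ] (unit M ℚ.≤ δ)
unit≤ {mkℚ (ℤ.+ suc a) d c} _ = d , subst (unit d ℚ.≤_) (ℚ.fromℚᵘ-toℚᵘ (mkℚ (ℤ.+ suc a) d c))
  (ratio-≤ 1 (suc d) (suc a) (suc d) z<s z<s (*-monoˡ-≤ (suc d) (s≤s {n = a} z≤n)))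
unit≤ {mkℚ (ℤ.+ zero) d c}   (ℚ.*<* (ℤ.+<+ ()))
unit≤ {mkℚ (ℤ.-[1+ a ]) d c} (ℚ.*<* ())

-- The limiting edge density of the complete balanced K-partite r-graph
density : ℕ → ℕ → ℚ
density K r = ratio (K ^̲ r) (K ^ r)

module _ (k-1 : ℕ) where

  private
    K = suc k-1

    0<K^ : ∀ r → 0 < K ^ r
    0<K^ r = m^n>0 K r

  -- The next factor of the product is `1 - r / K`, and the product so far is at most 1, so the drop
  -- is at most `r / K`.
  density-step : ∀ M r → r * suc M ≤ K → density K r ℚ.≤ density K (suc r) ℚ.+ unit M
  density-step M r rM≤K = ratio-≤-+ (K ^̲ r) (K ^ r) (K ^̲ suc r) (K ^ suc r) 1 (suc M) (0<K^ r) (0<K^ (suc r)) z<s (begin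
    K ^̲ r * (K * A * M′)                              ≡⟨ regroup (K ^̲ r) K A M′ ⟩
    (K ^̲ r * K) * M′ * A                              ≡⟨ cong (λ x → x * M′ * A) (^̲-split K r) ⟨
    (K ^̲ suc r + K ^̲ r * r) * M′ * A                  ≡⟨ regroup′ (K ^̲ suc r) (K ^̲ r) r M′ A ⟩
    (K ^̲ suc r * M′ + K ^̲ r * (r * M′)) * A           ≤⟨ *-monoˡ-≤ A (+-monoʳ-≤ (K ^̲ suc r * M′) (*-mono-≤ (^̲≤^ K r) rM≤K)) ⟩
    (K ^̲ suc r * M′ + A * K) * A                      ≡⟨ regroup″ (K ^̲ suc r * M′) A K ⟩
    (K ^̲ suc r * M′ + 1 * (K * A)) * A                ∎)
    where
    open ≤-Reasoning
    A = K ^ r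
    M′ = suc M
    regroup : ∀ f k a m → f * (k * a * m) ≡ (f * k) * m * a
    regroup = solve-∀
    regroup′ : ∀ g f r m a → (g + f * r) * m * a ≡ (g * m + f * (r * m)) * a
    regroup′ = solve-∀
    regroup″ : ∀ x a k → (x + a * k) * a ≡ (x + 1 * (k * a)) * a
    regroup″ = solve-∀

  -- By `^̲-triangle` the density is at most `K / (K + triangle r)`, whose denominator is here at
  -- least `suc M * K`.
  density-triangle : ∀ M r → M * K ≤ triangle r → density K r ℚ.≤ unit M
  density-triangle M r MK≤ = ratio-≤ (K ^̲ r) (K ^ r) 1 (suc M) (0<K^ r) z<s (*-cancelˡ-≤ K (begin
    K * (K ^̲ r * suc M)       ≡⟨ regroup K (K ^̲ r) M ⟩
    K ^̲ r * (K + M * K)       ≤⟨ *-monoʳ-≤ (K ^̲ r) (+-monoʳ-≤ K MK≤) ⟩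
    K ^̲ r * (K + triangle r)  ≤⟨ ^̲-triangle K r ⟩
    K * K ^ r                 ≡⟨ cong (K *_) (+-identityʳ (K ^ r)) ⟨
    K * (1 * K ^ r)           ∎))
    where
    open ≤-Reasoning
    regroup : ∀ k f m → k * (f * suc m) ≡ f * (k + m * k)
    regroup = solve-∀

2*triangle : ∀ r → 2 * triangle (suc r) ≡ r * suc r
2*triangle zero = refl
2*triangle (suc r) = trans (regroup (triangle (suc r)) r) (trans (cong (_+ 2 * suc r) (2*triangle r)) (regroup′ r))
  where
  regroup : ∀ t r → 2 * (t + suc r) ≡ 2 * t + 2 * suc r
  regroup = solve-∀
  regroup′ : ∀ r → r * suc r + 2 * suc r ≡ suc r * suc (suc r)
  regroup′ = solve-∀

-- `q` may leave the unit interval by `unit M`, since it will be a rational approximation to a real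
-- of that interval. The conditions on `K` give small steps up to rank `s` and a small density at
-- `s`.
module _ (M : ℕ) (q : ℚ) (0≤ : 0ℚ ℚ.≤ q ℚ.+ unit M) (≤1 : q ℚ.≤ 1ℚ ℚ.+ unit M)
         (k-1 L : ℕ) (sN≤K : (2 + L) * suc M ≤ suc k-1) (MK≤ : M * suc k-1 ≤ triangle (2 + L)) where

  private
    N = suc M
    s = 2 + L
    K = suc k-1
    u = unit M

    Found = ∃[ r ] (2 ≤ r × density K r ≈[ u ℚ.+ u ] q)

    0≤u : 0ℚ ℚ.≤ u
    0≤u = 0≤ratio 1 N

    step : ∀ r → r ≤ s → density K r ℚ.≤ density K (suc r) ℚ.+ u
    step r r≤s = density-step k-1 M r (≤-trans (*-monoˡ-≤ N r≤s) sN≤K)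

    within : ∀ r → 2 ≤ r → density K r ℚ.≤ q → q ℚ.≤ density K r ℚ.+ (u ℚ.+ u) → Found
    within r 2≤r d≤q q≤ = r , 2≤r , ℚ.≤-trans d≤q q≤q+2u , q≤
      where
      q≤q+2u : q ℚ.≤ q ℚ.+ (u ℚ.+ u)
      q≤q+2u = subst (ℚ._≤ q ℚ.+ (u ℚ.+ u)) (ℚ.+-identityʳ q) (ℚ.+-monoʳ-≤ q (ℚ.+-mono-≤ 0≤u 0≤u))

    -- The density at rank 1 is exactly 1. One `u` pays for the excess of `q` over 1, the other for
    -- the step to rank 2, the first admissible one.
    start : q ℚ.≤ density K 2 ℚ.+ (u ℚ.+ u)
    start = begin
      q                              ≤⟨ ≤1 ⟩
      1ℚ ℚ.+ u                       ≤⟨ ℚ.+-monoˡ-≤ u (ℚ.≤-trans 1≤ (step 1 (s≤s z≤n))) ⟩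
      (density K 2 ℚ.+ u) ℚ.+ u      ≡⟨ ℚ.+-assoc (density K 2) u u ⟩
      density K 2 ℚ.+ (u ℚ.+ u)      ∎
      where
      open ℚ.≤-Reasoning
      1≤ : 1ℚ ℚ.≤ density K 1
      1≤ = ratio-≤ 1 1 (1 * K) (K * 1) z<s z<s (≤-reflexive (base K))
        where
        base : ∀ k → 1 * (k * 1) ≡ 1 * k * 1
        base = solve-∀

    -- A discrete intermediate value argument: at the first rank whose density is at most `q`, the
    -- preceding density exceeds `q` by assumption and is only one small step away.
    walk : ∀ j → 2 + j ≤ s → Found ⊎ q ℚ.< density K (2 + j)
    walk zero 2≤s with q ℚ.<? density K 2
    ... | yes q< = inj₂ q<
    ... | no q≮  = inj₁ (within 2 ≤-refl (ℚ.≮⇒≥ q≮) start)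
    walk (suc j) j≤s with walk j (≤-trans (n≤1+n _) j≤s)
    ... | inj₁ found = inj₁ found
    ... | inj₂ q< with q ℚ.<? density K (3 + j)
    ...   | yes q<′ = inj₂ q<′
    ...   | no q≮   = inj₁ (within (3 + j) (s≤s (s≤s z≤n)) (ℚ.≮⇒≥ q≮) (begin
      q                              ≤⟨ ℚ.<⇒≤ q< ⟩
      density K (2 + j)              ≤⟨ step (2 + j) (≤-trans (n≤1+n _) j≤s) ⟩
      density K (3 + j) ℚ.+ u        ≤⟨ ℚ.+-monoʳ-≤ (density K (3 + j)) (subst (ℚ._≤ u ℚ.+ u) (ℚ.+-identityʳ u) (ℚ.+-monoʳ-≤ u 0≤u)) ⟩
      density K (3 + j) ℚ.+ (u ℚ.+ u) ∎))
      where open ℚ.≤-Reasoning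

  density-approximation : Found
  density-approximation with walk L ≤-refl
  ... | inj₁ found = found
  -- Here `q` lies below the density at `s`, which is at most `u`, while `q` is at least `- u`; the
  -- distance is therefore at most `u + u`.
  ... | inj₂ q<    = s , s≤s (s≤s z≤n) ,
    ℚ.≤-trans (density-triangle k-1 M s MK≤) (≤-by 0≤ (solve 2 (λ q u → (q :+ u) :- con 0ℚ := (q :+ (u :+ u)) :- u) refl q u)) ,
    ℚ.≤-trans (ℚ.<⇒≤ q<) (subst (ℚ._≤ density K s ℚ.+ (u ℚ.+ u)) (ℚ.+-identityʳ (density K s)) (ℚ.+-monoʳ-≤ (density K s) (ℚ.+-mono-≤ 0≤u 0≤u)))

-- With s = 2N² + 1 and K = s N, consecutive densities for r ≤ s differ by at
-- most s / K = 1 / N, and the last one is at most 1 / N.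
density-dense : ∀ M q → 0ℚ ℚ.≤ q ℚ.+ unit M → q ℚ.≤ 1ℚ ℚ.+ unit M →
                ∃[ k-1 ] ∃[ r ] (2 ≤ r × density (suc k-1) r ≈[ unit M ℚ.+ unit M ] q)
density-dense M q 0≤ ≤1 = K-1 , density-approximation M q 0≤ ≤1 K-1 L (≤-reflexive sN≡K) MK≤
  where
  N = suc M
  -- The rank is needed in the form `2 + L`, hence the predecessor; the argument is positive, so
  -- nothing is truncated.
  L = ℕ.pred (2 * (N * N))
  K-1 = ℕ.pred ((2 + L) * N)
  sN≡K : (2 + L) * N ≡ suc K-1
  sN≡K = refl
  2N²≡ : 2 * (N * N) ≡ suc L
  2N²≡ = refl
  regroup : ∀ n s → 2 * (n * (s * n)) ≡ 2 * (n * n) * s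
  regroup = solve-∀
  -- Since `s - 1` is `2 * (N * N)`, the triangular number `(s - 1) s / 2` is exactly `N * N * s`,
  -- that is `N` times `K`.
  triangle≡ : N * suc K-1 ≡ triangle (2 + L)
  triangle≡ = *-cancelˡ-≡ (N * suc K-1) (triangle (2 + L)) 2
    (trans (cong (λ k → 2 * (N * k)) (sym sN≡K)) (trans (regroup N (2 + L))
      (trans (cong (_* (2 + L)) 2N²≡) (sym (2*triangle (suc L))))))
  MK≤ : M * suc K-1 ≤ triangle (2 + L)
  MK≤ = ≤-trans (*-monoˡ-≤ (suc K-1) (n≤1+n M)) (≤-reflexive triangle≡)

-- Convergence of the edge ratios

module _ (k-1 r : ℕ) where

  open Turán k-1 r

  private K = suc k-1

  density≤ratio : ∀ n → 0 < n C r → density K r ℚ.≤ ratio (ex n) (n C r)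
  density≤ratio n 0<C = ratio-≤ (K ^̲ r) (K ^ r) (ex n) (n C r) (m^n>0 K r) 0<C
    (subst (_≤ ex n * K ^ r) (*-comm (n C r) (K ^̲ r)) (ex-lower n))

  ratio≤density : ∀ n → 0 < n → 0 < n C r → ratio (ex n) (n C r) ℚ.≤ density K r ℚ.+ ratio (r * r) n
  ratio≤density n 0<n 0<C = ratio-≤-+ (ex n) (n C r) F A (r * r) n 0<C (m^n>0 K r) 0<n
    (*-cancelˡ-≤ (n ^ r * r !) {{m*n≢0 (n ^ r) (r !) {{m^n≢0 n r {{>-nonZero 0<n}}}} {{r !≢0}}}} (begin
    n ^ r * r ! * (ex n * (A * n))
      ≡⟨ regroup (n ^ r) (r !) (ex n) A n ⟩
    A * r ! * ex n * (n * n ^ r)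
      ≤⟨ *-monoʳ-≤ (A * r ! * ex n) (^≤^̲+error n r) ⟩
    A * r ! * ex n * (n * n ^̲ r + r * r * n ^ r)
      ≡⟨ *-distribˡ-+ (A * r ! * ex n) (n * n ^̲ r) (r * r * n ^ r) ⟩
    A * r ! * ex n * (n * n ^̲ r) + A * r ! * ex n * (r * r * n ^ r)
      -- The main term takes the Maclaurin bound; for the error term the trivial bound
      -- `ex n ≤ n C r` is enough.
      ≤⟨ +-mono-≤ (*-monoˡ-≤ (n * n ^̲ r) (ex-upper n)) (*-monoˡ-≤ (r * r * n ^ r) (*-monoʳ-≤ (A * r !) (size≤C (proj₁ (proj₁ (isEx n)))))) ⟩
    F * n ^ r * (n * n ^̲ r) + A * r ! * (n C r) * (r * r * n ^ r)
      ≡⟨ cong (λ x → F * n ^ r * (n * x) + A * r ! * (n C r) * (r * r * n ^ r)) (C*!≡^̲ n r) ⟨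
    F * n ^ r * (n * ((n C r) * r !)) + A * r ! * (n C r) * (r * r * n ^ r)
      ≡⟨ regroup′ F (n ^ r) n (n C r) (r !) A r ⟩
    n ^ r * r ! * ((F * n + r * r * A) * (n C r)) ∎))
    where
    open ≤-Reasoning
    F = K ^̲ r
    A = K ^ r
    regroup : ∀ p f x a n → p * f * (x * (a * n)) ≡ a * f * x * (n * p)
    regroup = solve-∀
    regroup′ : ∀ g p n c f a r → g * p * (n * (c * f)) + a * f * c * (r * r * p) ≡ p * f * ((g * n + r * r * a) * c)
    regroup′ = solve-∀

  0<C : ∀ {n} → r ≤ n → 0 < n C r
  0<C {n} r≤n = n≢0⇒n>0 λ C≡0 → >⇒≢ (^̲-pos n r r≤n) (trans (sym (C*!≡^̲ n r)) (cong (_* r !) C≡0))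
    where
    ^̲-pos : ∀ n r → r ≤ n → 0 < n ^̲ r
    ^̲-pos n zero    _   = z<s
    ^̲-pos n (suc r) r<n = *-mono-≤ (^̲-pos n r (<⇒≤ r<n)) (m<n⇒0<n∸m r<n)

  -- In the threshold, `suc r` makes `n` and `n C r` positive, and `r * r * suc M` brings the error
  -- `r * r / n` down to `unit M`.
  ratio≈density : ∀ M n → suc r + r * r * suc M ≤ n → ratio (ex n) (n C r) ≈[ unit M ] density K r
  ratio≈density M n n≥ = close (ratio (ex n) (n C r)) (density≤ratio n 0<nCr) (ratio≤density n 0<n 0<nCr)
    where
    r<n : r < n
    r<n = m+n≤o⇒m≤o (suc r) n≥
    0<n : 0 < n
    0<n = ≤-trans z<s r<n
    0<nCr : 0 < n C r
    0<nCr = 0<C (<⇒≤ r<n)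
    error≤ : ratio (r * r) n ℚ.≤ unit M
    error≤ = ratio-≤ (r * r) n 1 (suc M) 0<n z<s (≤-trans (m+n≤o⇒n≤o (suc r) n≥) (≤-reflexive (sym (+-identityʳ n))))
    close : ∀ x → density K r ℚ.≤ x → x ℚ.≤ density K r ℚ.+ ratio (r * r) n → x ≈[ unit M ] density K r
    close x d≤x x≤ = ℚ.≤-trans x≤ (ℚ.+-monoʳ-≤ (density K r) error≤) ,
      ℚ.≤-trans d≤x (subst (ℚ._≤ x ℚ.+ unit M) (ℚ.+-identityʳ x) (ℚ.+-monoʳ-≤ x (0≤ratio 1 (suc M))))

-- Real limits

turán-density : ∀ k-1 r → fromℚ (density (suc k-1) r) ∈ Π∞ r
turán-density k-1 r = uncolourable , ex , isEx , converges
  where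
  open Turán k-1 r
  converges : (λ n → ratio (ex n) (n C r)) ⟶ fromℚ (density (suc k-1) r)
  -- The order on the reals demands a uniform positive gap. One half of `δ` bounds the distance and
  -- the other half is that gap.
  converges ε (δ , 0<δ , N , δ≤ε) with η , 0<η , η+η≡δ ← half 0<δ with M , u≤η ← unit≤ 0<η =
    suc r + r * r * suc M , λ n n≥ → η , 0<η , N , λ m m≥ → begin
      ℚ.∣ ratio (ex n) (n C r) ℚ.- density (suc k-1) r ∣ ℚ.+ η
        ≤⟨ ℚ.+-monoˡ-≤ η (ℚ.≤-trans (≈⇒∣-∣≤ (ratio≈density k-1 r M n n≥)) u≤η) ⟩
      η ℚ.+ η
        ≡⟨ η+η≡δ ⟩
      δ
        ≡⟨ ℚ.+-identityˡ δ ⟨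
      0ℚ ℚ.+ δ
        ≤⟨ δ≤ε m m≥ ⟩
      seq ε m ∎
    where open ℚ.≤-Reasoning

-- The closure lies in the unit interval

p+q≤r⇒p≤r : ∀ {p q r} → 0ℚ ℚ.< q → p ℚ.+ q ℚ.≤ r → p ℚ.≤ r
p+q≤r⇒p≤r {p} {q} {r} 0<q h = ℚ.≤-trans (subst (ℚ._≤ p ℚ.+ q) (ℚ.+-identityʳ p) (ℚ.+-monoʳ-≤ p (ℚ.<⇒≤ 0<q))) h

-- A point of the closure is near a Turán density, which is near some edge ratio `ex n / (n C r)`;
-- such ratios lie between 0 and 1. Each approximation costs half of `δ`.
closure-approx : ∀ {x} → x ∈ closure (λ p → ∃[ r ] (2 ≤ r × p ∈ Π∞ r)) → ∀ {δ} → 0ℚ ℚ.< δ →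
                 ∃[ q ] (0ℚ ℚ.≤ q × q ℚ.≤ 1ℚ × ∃[ N ] (∀ n → N ≤ n → q ≈[ δ ] seq x n))
closure-approx {x} x∈ {δ} 0<δ
  with η , 0<η , η+η≡δ ← half 0<δ
  with y , (r , _ , 𝓕 , ex , isEx , converges) , (δ₁ , 0<δ₁ , N₁ , near₁) ← x∈ (fromℚ η) (η , 0<η , 0 , λ _ _ → ℚ.≤-reflexive (ℚ.+-identityˡ η))
  with N₂ , eventually ← converges (fromℚ η) (η , 0<η , 0 , λ _ _ → ℚ.≤-reflexive (ℚ.+-identityˡ η))
  with δ₃ , 0<δ₃ , N₃ , near₃ ← eventually N₂ ≤-refl
  = ratio (ex N₂) (N₂ C r) , 0≤ratio (ex N₂) (N₂ C r) , ratio≤1 ex≤C , N₁ ⊔ N₃ , λ n n≥ →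
    subst (λ d → ratio (ex N₂) (N₂ C r) ≈[ d ] seq x n) η+η≡δ
      (≈-trans (∣-∣≤⇒≈ (p+q≤r⇒p≤r 0<δ₃ (near₃ n (m⊔n≤o⇒n≤o N₁ N₃ n≥))))
               (∣-∣≤⇒≈ (p+q≤r⇒p≤r 0<δ₁ (near₁ n (m⊔n≤o⇒m≤o N₁ N₃ n≥)))))
  where
  ex≤C : ex N₂ ≤ N₂ C r
  ex≤C with (G , _ , size≡) , _ ← isEx N₂ = subst (_≤ N₂ C r) size≡ (size≤C G)

private
  -- Adding the four inequalities cancels everything but `η`. A violated bound supplies a gap of
  -- `η + η`, of which the approximation recovers only one `η`.
  no-gap : ∀ {a b q η z} → a ℚ.≤ q → q ℚ.≤ z ℚ.+ η → z ℚ.+ (η ℚ.+ η) ℚ.≤ b → b ℚ.≤ a → η ℚ.≤ 0ℚ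
  no-gap {a} {b} {q} {η} {z} h₁ h₂ h₃ h₄ = ≤-by (ℚ.+-mono-≤ (ℚ.+-mono-≤ (ℚ.+-mono-≤ h₁ h₂) h₃) h₄)
    (solve 5 (λ a b q η z → (((q :+ (z :+ η)) :+ b) :+ a) :- (((a :+ q) :+ (z :+ (η :+ η))) :+ b) := con 0ℚ :- η) refl a b q η z)

  below-zero : ∀ {x y} → x ℚ.≤ y → x ℚ.+ ℚ.- y ℚ.≤ 0ℚ
  below-zero {x} {y} x≤y = ≤-by x≤y (solve 2 (λ x y → y :- x := con 0ℚ :- (x :+ :- y)) refl x y)

  above : ∀ {a q u x} → q ℚ.≤ x ℚ.+ u → a ℚ.+ (q ℚ.- (a ℚ.+ u)) ℚ.≤ x
  above {a} {q} {u} {x} h = ≤-by h (solve 4 (λ a q u x → (x :+ u) :- q := x :- (a :+ (q :- (a :+ u)))) refl a q u x)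

approximable⇒∈[0,1] : ∀ (x : ℝ) →
  (∀ δ → 0ℚ ℚ.< δ → ∃[ q ] (0ℚ ℚ.≤ q × q ℚ.≤ 1ℚ × ∃[ N ] (∀ n → N ≤ n → q ≈[ δ ] seq x n))) →
  x ∈ [0,1]
approximable⇒∈[0,1] x approx = 0≤x , x≤1
  where
  0≤x : 0ℝ Real.≤ x
  0≤x (δ , 0<δ , N , x+δ≤0) = go (half 0<δ)
    where
    go : ¬ (∃[ η ] (0ℚ ℚ.< η × η ℚ.+ η ≡ δ))
    go (η , 0<η , refl) with approx η 0<η
    ... | q , 0≤q , _ , N′ , near = ℚ.<-irrefl refl (ℚ.<-≤-trans 0<η
      (no-gap {z = seq x (N ⊔ N′)} 0≤q (proj₁ (near (N ⊔ N′) (m≤n⊔m N N′))) (x+δ≤0 (N ⊔ N′) (m≤m⊔n N N′)) ℚ.≤-refl))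
  x≤1 : x Real.≤ 1ℝ
  x≤1 (δ , 0<δ , N , 1+δ≤x) = go (half 0<δ)
    where
    go : ¬ (∃[ η ] (0ℚ ℚ.< η × η ℚ.+ η ≡ δ))
    go (η , 0<η , refl) with approx η 0<η
    ... | q , _ , q≤1 , N′ , near = ℚ.<-irrefl refl (ℚ.<-≤-trans 0<η
      (no-gap {z = 1ℚ} (proj₂ (near (N ⊔ N′) (m≤n⊔m N N′))) (ℚ.+-monoˡ-≤ η q≤1) (1+δ≤x (N ⊔ N′) (m≤m⊔n N N′)) ℚ.≤-refl))

-- The unit interval lies in the closure

four-units≤ : ∀ {δ} → 0ℚ ℚ.< δ → ∃[ M ] (unit M ℚ.+ unit M ℚ.+ unit M ℚ.+ unit M ℚ.≤ δ)
four-units≤ {δ} 0<δ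
  with η , 0<η , η+η≡δ ← half 0<δ
  with θ , 0<θ , θ+θ≡η ← half 0<η
  with M , u≤θ ← unit≤ 0<θ = M , bound (unit M) u≤θ
  where
  bound : ∀ u → u ℚ.≤ θ → u ℚ.+ u ℚ.+ u ℚ.+ u ℚ.≤ δ
  bound u u≤θ = begin
    u ℚ.+ u ℚ.+ u ℚ.+ u     ≡⟨ ℚ.+-assoc (u ℚ.+ u) u u ⟩
    (u ℚ.+ u) ℚ.+ (u ℚ.+ u) ≤⟨ ℚ.+-mono-≤ (ℚ.+-mono-≤ u≤θ u≤θ) (ℚ.+-mono-≤ u≤θ u≤θ) ⟩
    (θ ℚ.+ θ) ℚ.+ (θ ℚ.+ θ) ≡⟨ cong₂ ℚ._+_ θ+θ≡η θ+θ≡η ⟩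
    η ℚ.+ η                 ≡⟨ η+η≡δ ⟩
    δ                       ∎
    where open ℚ.≤-Reasoning

[0,1]⊆closure : ∀ {x} → x ∈ [0,1] → x ∈ closure (λ p → ∃[ r ] (2 ≤ r × p ∈ Π∞ r))
[0,1]⊆closure {x} (0≤x , x≤1) ε (δ , 0<δ , N , δ≤ε) = choose-unit (four-units≤ 0<δ)
  where
  Goal = ∃[ y ] ((∃[ r ] (2 ≤ r × y ∈ Π∞ r)) × Real.∣ y Real.- x ∣ Real.< ε)

  module _ (u : ℚ) (0<u : 0ℚ ℚ.< u) (4u≤δ : u ℚ.+ u ℚ.+ u ℚ.+ u ℚ.≤ δ)
           (q : ℚ) (N′ : ℕ) (near : ∀ n → N′ ≤ n → q ≈[ u ] seq x n) where

    0≤q+u : 0ℚ ℚ.≤ q ℚ.+ u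
    -- If `q + u` were negative, its negation would be a gap witnessing that `x` is below zero.
    0≤q+u = ℚ.≮⇒≥ λ q+u<0 → 0≤x (ℚ.- (q ℚ.+ u) , ℚ.neg-antimono-< q+u<0 , N′ , λ n n≥ →
      below-zero {seq x n} {q ℚ.+ u} (proj₂ (near n n≥)))

    q≤1+u : q ℚ.≤ 1ℚ ℚ.+ u
    q≤1+u = ℚ.≮⇒≥ λ 1+u<q → x≤1 (q ℚ.- (1ℚ ℚ.+ u) ,
      subst (ℚ._< q ℚ.- (1ℚ ℚ.+ u)) (ℚ.+-inverseʳ (1ℚ ℚ.+ u)) (ℚ.+-monoˡ-< (ℚ.- (1ℚ ℚ.+ u)) 1+u<q) ,
      N′ , λ n n≥ → above {1ℚ} {q} {u} (proj₁ (near n n≥)))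

    close⇒<ε : ∀ p → p ≈[ u ℚ.+ u ] q → Real.∣ fromℚ p Real.- x ∣ Real.< ε
    close⇒<ε p close = u , 0<u , N ⊔ N′ , λ n n≥ → begin
      ℚ.∣ p ℚ.- seq x n ∣ ℚ.+ u
        ≤⟨ ℚ.+-monoˡ-≤ u (≈⇒∣-∣≤ (≈-trans close (near n (m⊔n≤o⇒n≤o N N′ n≥)))) ⟩
      -- Two units lead from the density to `q`, one from `q` to `x`, and the last is the gap
      -- required by the strict order.
      u ℚ.+ u ℚ.+ u ℚ.+ u
        ≤⟨ 4u≤δ ⟩
      δ
        ≡⟨ ℚ.+-identityˡ δ ⟨
      0ℚ ℚ.+ δ
        ≤⟨ δ≤ε n (m⊔n≤o⇒m≤o N N′ n≥) ⟩
      seq ε n ∎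
      where open ℚ.≤-Reasoning

  choose-unit : ∃[ M ] (unit M ℚ.+ unit M ℚ.+ unit M ℚ.+ unit M ℚ.≤ δ) → Goal
  choose-unit (M , 4u≤δ) = choose-index (cauchy x u (0<unit M))
    where
    u = unit M
    choose-index : ∃[ N′ ] (∀ m n → N′ ≤ m → N′ ≤ n → ℚ.∣ seq x m ℚ.- seq x n ∣ ℚ.< u) → Goal
    choose-index (N′ , x-cauchy) =
      choose-density (density-dense M q (0≤q+u u 0<u 4u≤δ q N′ near) (q≤1+u u 0<u 4u≤δ q N′ near))
      where
      0<u : 0ℚ ℚ.< u
      0<u = 0<unit M
      -- A term from which on the sequence varies by less than `u`, so it stays within `u` of the
      -- tail.
      q = seq x N′
      near : ∀ n → N′ ≤ n → q ≈[ u ] seq x n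
      near n n≥ = ∣-∣≤⇒≈ (ℚ.<⇒≤ (x-cauchy N′ n ≤-refl n≥))
      choose-density : ∃[ k-1 ] ∃[ r ] (2 ≤ r × density (suc k-1) r ≈[ u ℚ.+ u ] q) → Goal
      choose-density (k-1 , r , 2≤r , close) =
        fromℚ (density (suc k-1) r) , (r , 2≤r , turán-density k-1 r) ,
        close⇒<ε u 0<u 4u≤δ q N′ near (density (suc k-1) r) close

corollary2 : closure (λ p → ∃[ r ] (2 ≤ℕ r × p ∈ Π∞ r)) ≐ [0,1]
corollary2 = (λ {x} x∈ → approximable⇒∈[0,1] x (λ δ → closure-approx {x} x∈)) , λ {x} → [0,1]⊆closure {x}
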